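{- For any $\epsilon>0$, the adaptive weight order algorithm, which at every time $t$ processes every $j\in F_t$ with rate $(H_{|F_t|}\cdot i_j)^{ -1}$, where $i_j$ is the position of $j$ in $\hat\preceq_t$, has a competitive ratio of at most $4H_\omega\cdot\max\{1+\epsilon,\mathcal L(\epsilon)\}$ for minimizing the total weighted completion time on a single machine with online out-forest precedence constraints.
   Context: Problem (non-clairvoyant single-machine scheduling with online precedence constraints): jobs $J$ with processing requirements $p_j\ge0$ and weights $w_j\ge0$; precedence DAG $G=(J,E)$ which is an out-forest (every job has at most one incoming edge). A job may be processed only after all its predecessors are completed and is revealed (without its processing requirement) only then; $G$ is unknown. Time is discrete; rates $R_j^t\ge0$, $\sum_jR_j^t\le1$; $C_j$ is the first $t$ with $\sum_{t'\le t}R_j^{t'}\ge p_j$. Front jobs: $F_t=\{j: C_j>t,\ C_{j'}<t\ \forall(j',j)\in E\}$. Objective: minimize $\sum_jw_jC_j$ against the offline optimum. The width $\omega$ is the maximum size of an antichain of $G$; $H_k=\sum_{i=1}^k 1/i$. $S(v)$ is $v$ with all its successors, $w(S(v))=\sum_{u\in S(v)}w_u$. Adaptive weight order predictions: at each time $t$ the algorithm receives a total order $\hat\preceq_t$ on $F_t$, a prediction of the order of $F_t$ by non-increasing $w(S(\cdot))$. For $\epsilon>0$, $\mathcal L(\epsilon)=\max_{t,\,j\in F_t}\left|\left\{i\in F_t:\ \frac{w(S(j))}{1+\epsilon}\ge w(S(i))\text{ and } i\,\hat\preceq_t\, j\right\}\right|$.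
   Formalization: Processing requirements, weights, ε and the rates of the compared offline schedules are rational rather than real; F_t is read as the released jobs not completed before slot t (C_j ≥ t), and a job with p_j = 0 completes only after its predecessor. -}

module Defs where

open import Data.Nat as ℕ using (ℕ; zero; suc)
open import Data.Fin using (Fin)
import Data.Fin.Properties as FinP
open import Data.Maybe using (Maybe; just; nothing; _>>=_)
open import Data.Bool using (Bool; true; false; _∧_; _∨_; if_then_else_)
open import Data.List using (List; length)
open import Data.List.Relation.Unary.Unique.Propositional using (Unique)
open import Data.List.Membership.Propositional using (_∈_)
open import Data.Integer using (+_)
open import Data.Rational using (ℚ; 0ℚ; 1ℚ; _+_; _*_; _/_; 1/_; _≤_; _<_; ≢-nonZero)
open import Data.Rational.Properties using (_≟_; _≤?_)
open import Data.Product using (Σ; ∃; _×_; _,_)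
open import Relation.Nullary using (¬_; yes; no)
open import Relation.Nullary.Decidable using (⌊_⌋)
open import Relation.Binary.PropositionalEquality using (_≡_; _≢_)

ℕ→ℚ : ℕ → ℚ
ℕ→ℚ n = + n / 1

sumFin : ∀ {n} → (Fin n → ℚ) → ℚ
sumFin {zero}  f = 0ℚ
sumFin {suc n} f = f Fin.zero + sumFin {n} (λ i → f (Fin.suc i))
  where import Data.Fin as Fin

countFin : ∀ {n} → (Fin n → Bool) → ℕ
countFin {zero}  b = 0
countFin {suc n} b = (if b Fin.zero then 1 else 0) ℕ.+ countFin {n} (λ i → b (Fin.suc i))
  where import Data.Fin as Fin

-- multiplicative inverse, with the (irrelevant) convention 1/0 := 0
inv : ℚ → ℚ
inv q with q ≟ 0ℚ
... | yes _  = 0ℚ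
... | no q≢0 = 1/_ q {{≢-nonZero q≢0}}

H : ℕ → ℚ
H zero    = 0ℚ
H (suc k) = H k + (+ 1 / suc k)

-- Out-forests on the job set Fin n: every job has at most one parent
-- (its unique incoming edge), and the parent relation is acyclic.

Forest : ℕ → Set
Forest n = Fin n → Maybe (Fin n)

module _ {n : ℕ} (par : Forest n) where

  anc : ℕ → Fin n → Maybe (Fin n)
  anc zero    u = just u
  anc (suc k) u = anc k u >>= par

  ProperPred : Fin n → Fin n → Set
  ProperPred v u = ∃ λ k → anc (suc k) u ≡ just v

  Acyclic : Set
  Acyclic = ∀ u → ¬ ProperPred u u

  -- Boolean test: u ∈ S(v), i.e. u = v or u is a successor of v.
  -- (In an acyclic forest on n nodes, paths have length < n.)
  inS : Fin n → Fin n → Bool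
  inS v u = go n
    where
    isV : Maybe (Fin n) → Bool
    isV (just x) = ⌊ x FinP.≟ v ⌋
    isV nothing  = false
    go : ℕ → Bool
    go zero    = isV (anc zero u)
    go (suc k) = isV (anc (suc k) u) ∨ go k

  wS : (Fin n → ℚ) → Fin n → ℚ
  wS w v = sumFin (λ u → if inS v u then w u else 0ℚ)

  Antichain : List (Fin n) → Set
  Antichain A = Unique A × (∀ u v → u ∈ A → v ∈ A → ¬ ProperPred u v)

  IsWidth : ℕ → Set
  IsWidth ω = (Σ (List (Fin n)) λ A → Antichain A × length A ≡ ω)
            × (∀ A → Antichain A → length A ℕ.≤ ω)

  -- Schedules.  Time slots are t = 1, 2, 3, ...; R t j is the rate of
  -- job j in slot t (the value at t = 0 is ignored).

  Rates : Set
  Rates = ℕ → Fin n → ℚ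

  cum : Rates → ℕ → Fin n → ℚ
  cum R zero    j = 0ℚ
  cum R (suc t) j = cum R t j + R (suc t) j

  Ready : (Fin n → ℕ) → Fin n → ℕ → Set
  Ready C j t = ∀ j' → par j ≡ just j' → C j' ℕ.< t

  IsCompletion : (Fin n → ℚ) → Rates → (Fin n → ℕ) → Set
  IsCompletion p R C = ∀ j →
      (1 ℕ.≤ C j × Ready C j (C j) × p j ≤ cum R (C j) j)
    × (∀ t → 1 ℕ.≤ t → t ℕ.< C j → ¬ (Ready C j t × p j ≤ cum R t j))

  Feasible : Rates → (Fin n → ℕ) → Set
  Feasible R C = ∀ t → 1 ℕ.≤ t →
      (∀ j → 0ℚ ≤ R t j)
    × sumFin (R t) ≤ 1ℚ
    × (∀ j → 0ℚ < R t j → Ready C j t)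

  front : (Fin n → ℕ) → ℕ → Fin n → Bool
  front C t j = ⌊ t ℕ.≤? C j ⌋ ∧ parOK (par j)
    where
    parOK : Maybe (Fin n) → Bool
    parOK nothing   = true
    parOK (just j') = ⌊ C j' ℕ.<? t ⌋

  InFront : (Fin n → ℕ) → ℕ → Fin n → Set
  InFront C t j = front C t j ≡ true

  cost : (Fin n → ℚ) → (Fin n → ℕ) → ℚ
  cost w C = sumFin (λ j → w j * ℕ→ℚ (C j))

  -- Predictions: at time t, the total order \hat⪯_t on F_t is given by
  -- an injective key  pred t : Fin n → ℕ  via  i \hat⪯_t j ⇔ pred t i ≤ pred t j.

  Predictions : Set
  Predictions = ℕ → Fin n → ℕ

  ValidPredictions : Predictions → Set
  ValidPredictions π = ∀ t i j → π t i ≡ π t j → i ≡ j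

  -- position i_j of j in \hat⪯_t restricted to F_t (1-based)
  position : Predictions → (Fin n → ℕ) → ℕ → Fin n → ℕ
  position π C t j = countFin (λ i → front C t i ∧ ⌊ π t i ℕ.≤? π t j ⌋)

  algRate : Predictions → (Fin n → ℕ) → ℕ → Fin n → ℚ
  algRate π C t j =
    if front C t j
    then inv (H (countFin (front C t)) * ℕ→ℚ (position π C t j))
    else 0ℚ

  IsAlgRun : (Fin n → ℚ) → Predictions → Rates → (Fin n → ℕ) → Set
  IsAlgRun p π R C =
    IsCompletion p R C × (∀ t → 1 ℕ.≤ t → ∀ j → R t j ≡ algRate π C t j)

  Lcount : (Fin n → ℚ) → ℚ → Predictions → (Fin n → ℕ) → ℕ → Fin n → ℕ
  Lcount w ε π C t j = countFin (λ i →
      front C t i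
    ∧ ⌊ (1ℚ + ε) * wS w i ≤? wS w j ⌋
    ∧ ⌊ π t i ℕ.≤? π t j ⌋)

  -- L is L(ε) = max_{t, j ∈ F_t} Lcount (least upper bound; 0 if empty)
  IsL : (Fin n → ℚ) → ℚ → Predictions → (Fin n → ℕ) → ℕ → Set
  IsL w ε π C L =
      (∀ t j → 1 ℕ.≤ t → InFront C t j → Lcount w ε π C t j ℕ.≤ L)
    × (∀ L' → (∀ t j → 1 ℕ.≤ t → InFront C t j → Lcount w ε π C t j ℕ.≤ L')
            → L ℕ.≤ L')

{-# OPTIONS --safe #-}
module Submission where

open import Defs
import Data.Bool.Properties as BoolP
open import Data.Bool using (Bool; true; false; if_then_else_; _∧_; not)
open import Data.Fin as Fin using (Fin; toℕ)
import Data.Fin.Properties as FinP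
import Data.Integer as ℤ
import Data.Integer.Properties as ℤP
open import Data.List as List using (filter; allFin; length)
open import Data.List.Membership.Propositional.Properties using (∈-filter⁻)
import Data.List.Relation.Unary.Unique.Propositional.Properties as UniqueP
open import Data.Maybe using (just; nothing; _>>=_)
open import Data.Maybe.Properties using (just-injective)
open import Data.Nat as ℕ using (ℕ; zero; suc)
import Data.Nat.Properties as ℕP
open import Data.Product using (∃; _×_; _,_; proj₁; proj₂)
open import Data.Rational using (ℚ; 0ℚ; 1ℚ; _+_; _*_; -_; _/_; _≤_; _<_; _⊔_; mkℚ; toℚᵘ; nonNegative; positive; ≢-nonZero; *≤*)
open import Data.Rational.Properties
open import Data.Rational.Solver using (module +-*-Solver)
import Data.Rational.Unnormalised as ℚᵘ
import Data.Rational.Unnormalised.Properties as ℚᵘP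
open import Data.Sum using (_⊎_; inj₁; inj₂)
open import Function using (_∘_; case_of_)
open import Relation.Binary using (tri<; tri≈; tri>)
open import Relation.Nullary using (¬_; Dec; yes; no; contradiction)
open import Relation.Nullary.Decidable using (⌊_⌋; _×-dec_)
open import Relation.Binary.PropositionalEquality using (_≡_; _≢_; refl; sym; trans; cong; cong₂; subst; module ≡-Reasoning)

-- Write x_a = w(S(a)), let r_a be the rate of a in a given slot with front F,
-- put M = max(1 + ε, L), and let C′ be the completion times of an arbitrary
-- schedule.  The cost of the algorithm is the sum over all slots of Σ_{a ∈ F} x_a.
-- A job b of rank i has at most L jobs ahead of it that are lighter by a factor
-- 1 + ε, and any other job a ahead of it satisfies
-- r_b x_b ≤ (1 + ε) min(r_a x_b , r_b x_a).  As r_b = 1 / (H_|F| i), this gives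
-- Σ_{b ∈ F} x_b ≤ 2 M H_|F| Σ_{{a,b} ⊆ F} min(r_a x_b , r_b x_a), with pairs a = b
-- included.  If neither a nor b is in its last slot, the minimum is charged to the
-- one that C′ completes first, say a, as r_a times weight completed by C′ not
-- before a; over all slots these charges add up to at most
-- Σ_a p_a Σ {w_k : C′_a ≤ C′_k} ≤ Σ_k w_k C′_k.  If b is in its last slot, the charge
-- is r_a x_b; since the rates sum to at most 1, these add up to at most
-- Σ_b x_b = Σ_k w_k · depth(k) ≤ Σ_k w_k C′_k.  Together this is the factor 4 M H_ω.

-- Booleans and decisions

⌊⌋-sound : {P : Set} (P? : Dec P) → ⌊ P? ⌋ ≡ true → P
⌊⌋-sound (yes p) _ = p

⌊⌋-complete : {P : Set} (P? : Dec P) → P → ⌊ P? ⌋ ≡ true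
⌊⌋-complete (yes _) _ = refl
⌊⌋-complete (no ¬p) p = contradiction p ¬p

∧-intro : ∀ {x y} → x ≡ true → y ≡ true → x ∧ y ≡ true
∧-intro refl refl = refl

∧-elimˡ : ∀ {x y} → x ∧ y ≡ true → x ≡ true
∧-elimˡ {true} _ = refl

∧-elimʳ : ∀ {x y} → x ∧ y ≡ true → y ≡ true
∧-elimʳ {true} h = h

≡true-iff : ∀ {x y} → (x ≡ true → y ≡ true) → (y ≡ true → x ≡ true) → x ≡ y
≡true-iff {true}  {y}     f g = sym (f refl)
≡true-iff {false} {true}  f g = g refl
≡true-iff {false} {false} f g = refl

⌊⌋-refute : {P : Set} (P? : Dec P) → ¬ P → ⌊ P? ⌋ ≡ false
⌊⌋-refute (yes p) ¬p = contradiction p ¬p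
⌊⌋-refute (no _)  _  = refl

not-< : ∀ {a b} → not ⌊ a ℕ.<? b ⌋ ≡ true → b ℕ.≤ a
not-< {a} {b} h with a ℕ.<? b
... | no ¬lt = ℕP.≮⇒≥ ¬lt

if-true : ∀ {A : Set} {b} {x y : A} → b ≡ true → (if b then x else y) ≡ x
if-true refl = refl

if-false : ∀ {A : Set} {b} {x y : A} → b ≡ false → (if b then x else y) ≡ y
if-false refl = refl

true-or-false : ∀ b → b ≡ true ⊎ b ≡ false
true-or-false true  = inj₁ refl
true-or-false false = inj₂ refl

-- Rationals

private
  variable
    m n : ℕ
    a b c d : ℚ

*-monoʳ-≤ : 0ℚ ≤ c → a ≤ b → c * a ≤ c * b
*-monoʳ-≤ {c} 0≤c = *-monoˡ-≤-nonNeg c {{nonNegative 0≤c}}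

*-monoˡ-≤ : 0ℚ ≤ c → a ≤ b → a * c ≤ b * c
*-monoˡ-≤ {c} 0≤c = *-monoʳ-≤-nonNeg c {{nonNegative 0≤c}}

0≤+ : 0ℚ ≤ a → 0ℚ ≤ b → 0ℚ ≤ a + b
0≤+ = +-mono-≤

0≤* : 0ℚ ≤ a → 0ℚ ≤ b → 0ℚ ≤ a * b
0≤* {a} 0≤a 0≤b = ≤-trans (≤-reflexive (sym (*-zeroʳ a))) (*-monoʳ-≤ 0≤a 0≤b)

0<* : 0ℚ < a → 0ℚ < b → 0ℚ < a * b
0<* {a} {b} 0<a 0<b = positive⁻¹ (a * b) {{pos*pos⇒pos a {{positive 0<a}} b {{positive 0<b}}}}

0≤1 : 0ℚ ≤ 1ℚ
0≤1 = *≤* (ℤ.+≤+ ℕ.z≤n)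

≤-+ʳ : 0ℚ ≤ b → a ≤ a + b
≤-+ʳ {b} {a} 0≤b = ≤-trans (≤-reflexive (sym (+-identityʳ a))) (+-monoʳ-≤ a 0≤b)

≤-+ˡ : 0ℚ ≤ b → a ≤ b + a
≤-+ˡ {b} {a} 0≤b = ≤-trans (≤-+ʳ 0≤b) (≤-reflexive (+-comm a b))

+-cancel-≤ : a + c ≤ b + d → d ≤ c → a ≤ b
+-cancel-≤ {a} {c} {b} {d} h d≤c = begin
  a              ≡⟨ cancel a c ⟩
  a + c + (- c)  ≤⟨ +-mono-≤ h (neg-antimono-≤ d≤c) ⟩
  b + d + (- d)  ≡⟨ sym (cancel b d) ⟩
  b              ∎
  where
  open ≤-Reasoning
  cancel : ∀ a c → a ≡ a + c + (- c)
  cancel = solve 2 (λ a c → a := a :+ c :+ (:- c)) refl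
    where open +-*-Solver

-- The embedding of ℕ, harmonic numbers and inverses

-- Reduction to lowest terms in `_/_` does not compute on variables, so identities between fractions
-- are verified on unnormalised rationals.
toℚᵘ-/ : ∀ i k → toℚᵘ (i / suc k) ℚᵘ.≃ ℚᵘ.mkℚᵘ i k
toℚᵘ-/ i k = toℚᵘ-fromℚᵘ (ℚᵘ.mkℚᵘ i k)

ℕ→ℚ-suc : ∀ n → ℕ→ℚ (suc n) ≡ 1ℚ + ℕ→ℚ n
ℕ→ℚ-suc n = toℚᵘ-injective (begin
  toℚᵘ (ℕ→ℚ (suc n))                   ≈⟨ toℚᵘ-/ (ℤ.+ suc n) 0 ⟩
  ℚᵘ.mkℚᵘ (ℤ.+ suc n) 0                  ≈⟨ ℚᵘ.*≡* (cong (λ z → (ℤ.+ 1 ℤ.+ z) ℤ.* ℤ.+ 1) (sym (ℤP.*-identityʳ (ℤ.+ n)))) ⟩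
  ℚᵘ.1ℚᵘ ℚᵘ.+ ℚᵘ.mkℚᵘ (ℤ.+ n) 0           ≈⟨ ℚᵘP.+-congʳ ℚᵘ.1ℚᵘ (ℚᵘP.≃-sym (toℚᵘ-/ (ℤ.+ n) 0)) ⟩
  ℚᵘ.1ℚᵘ ℚᵘ.+ toℚᵘ (ℕ→ℚ n)              ≈⟨ ℚᵘP.≃-sym (toℚᵘ-homo-+ 1ℚ (ℕ→ℚ n)) ⟩
  toℚᵘ (1ℚ + ℕ→ℚ n)                    ∎)
  where open ℚᵘP.≃-Reasoning

0≤ℕ→ℚ : ∀ n → 0ℚ ≤ ℕ→ℚ n
0≤ℕ→ℚ zero    = ≤-refl
0≤ℕ→ℚ (suc n) = ≤-trans (0≤+ 0≤1 (0≤ℕ→ℚ n)) (≤-reflexive (sym (ℕ→ℚ-suc n)))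

ℕ→ℚ-mono : m ℕ.≤ n → ℕ→ℚ m ≤ ℕ→ℚ n
ℕ→ℚ-mono {n = n} ℕ.z≤n = 0≤ℕ→ℚ n
ℕ→ℚ-mono (ℕ.s≤s {m} {n} m≤n) = begin
  ℕ→ℚ (suc m)   ≡⟨ ℕ→ℚ-suc m ⟩
  1ℚ + ℕ→ℚ m    ≤⟨ +-monoʳ-≤ 1ℚ (ℕ→ℚ-mono m≤n) ⟩
  1ℚ + ℕ→ℚ n    ≡⟨ sym (ℕ→ℚ-suc n) ⟩
  ℕ→ℚ (suc n)   ∎
  where open ≤-Reasoning

0<1 : 0ℚ < 1ℚ
0<1 = positive⁻¹ 1ℚ

0<ℕ→ℚ : ∀ n → 0ℚ < ℕ→ℚ (suc n)
0<ℕ→ℚ n = <-≤-trans 0<1 (ℕ→ℚ-mono {1} {suc n} (ℕ.s≤s ℕ.z≤n))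

ℕ→ℚ-cancel-≤ : ℕ→ℚ m ≤ ℕ→ℚ n → m ℕ.≤ n
ℕ→ℚ-cancel-≤ {m} {n} h with m ℕ.≤? n
... | yes m≤n = m≤n
... | no  m≰n = contradiction
  (<-≤-trans n<1+n (≤-trans (≤-reflexive (sym (ℕ→ℚ-suc n))) (≤-trans (ℕ→ℚ-mono (ℕP.≰⇒> m≰n)) h)))
  (<-irrefl refl)
  where
  n<1+n : ℕ→ℚ n < 1ℚ + ℕ→ℚ n
  n<1+n = ≤-<-trans (≤-reflexive (sym (+-identityˡ _))) (+-monoˡ-< (ℕ→ℚ n) 0<1)

-- The denominator is at least 1, so the absolute value of the numerator is a witness.
≤-archimedean : ∀ q → ∃ λ k → q ≤ ℕ→ℚ k
≤-archimedean q@(mkℚ i k _) = ℤ.∣ i ∣ , toℚᵘ-cancel-≤ (ℚᵘP.≤-trans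
  (ℚᵘ.*≤* (ℤP.≤-trans i*1≤∣i∣ (ℤP.≤-trans (ℤP.≤-reflexive (sym (ℤP.*-identityʳ _)))
     (ℤP.*-monoˡ-≤-nonNeg (ℤ.+ ℤ.∣ i ∣) (ℤ.+≤+ (ℕ.s≤s (ℕ.z≤n {k})))))))
  (ℚᵘP.≤-reflexive (ℚᵘP.≃-sym (toℚᵘ-/ (ℤ.+ ℤ.∣ i ∣) 0))))
  where
  i≤∣i∣ : ∀ i → i ℤ.≤ ℤ.+ ℤ.∣ i ∣
  i≤∣i∣ (ℤ.+ n)        = ℤP.≤-refl
  i≤∣i∣ ℤ.-[1+ n ]   = ℤ.-≤+
  i*1≤∣i∣ : i ℤ.* ℤ.+ 1 ℤ.≤ ℤ.+ ℤ.∣ i ∣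
  i*1≤∣i∣ = ℤP.≤-trans (ℤP.≤-reflexive (ℤP.*-identityʳ i)) (i≤∣i∣ i)

ℕ→ℚ-*-1/ : ∀ k → ℕ→ℚ (suc k) * (ℤ.+ 1 / suc k) ≡ 1ℚ
ℕ→ℚ-*-1/ k = toℚᵘ-injective (begin
  toℚᵘ (ℕ→ℚ (suc k) * (ℤ.+ 1 / suc k))              ≈⟨ toℚᵘ-homo-* (ℕ→ℚ (suc k)) (ℤ.+ 1 / suc k) ⟩
  toℚᵘ (ℕ→ℚ (suc k)) ℚᵘ.* toℚᵘ (ℤ.+ 1 / suc k)       ≈⟨ ℚᵘP.*-cong (toℚᵘ-/ (ℤ.+ suc k) 0) (toℚᵘ-/ (ℤ.+ 1) k) ⟩
  ℚᵘ.mkℚᵘ (ℤ.+ suc k) 0 ℚᵘ.* ℚᵘ.mkℚᵘ (ℤ.+ 1) k          ≈⟨ ℚᵘ.*≡* (cong (λ k → ℤ.+ suc k) (trans (ℕP.*-identityʳ _) (trans (ℕP.*-identityʳ k) (sym (trans (ℕP.+-identityʳ _) (ℕP.+-identityʳ k)))))) ⟩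
  ℚᵘ.1ℚᵘ                                           ∎)
  where open ℚᵘP.≃-Reasoning

0≤1/ : ∀ k → 0ℚ ≤ ℤ.+ 1 / suc k
0≤1/ k = nonNegative⁻¹ (ℤ.+ 1 / suc k) {{normalize-nonNeg 1 (suc k)}}

H-mono : m ℕ.≤ n → H m ≤ H n
H-mono {m} {n} m≤n = ≤-trans (mono (n ℕ.∸ m)) (≤-reflexive (cong H (ℕP.m∸n+n≡m m≤n)))
  where
  mono : ∀ k → H m ≤ H (k ℕ.+ m)
  mono zero    = ≤-refl
  mono (suc k) = ≤-trans (mono k) (≤-+ʳ (0≤1/ (k ℕ.+ m)))

0≤H : ∀ k → 0ℚ ≤ H k
0≤H k = H-mono {0} {k} ℕ.z≤n

0<H : 0 ℕ.< m → 0ℚ < H m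
0<H {m} 0<m = <-≤-trans 0<1 (H-mono {1} {m} 0<m)

inv-inverseˡ : 0ℚ < a → inv a * a ≡ 1ℚ
inv-inverseˡ {a} 0<a with a ≟ 0ℚ
... | yes a≡0 = contradiction (sym a≡0) (<⇒≢ 0<a)
... | no  a≢0 = *-inverseˡ a {{≢-nonZero a≢0}}

inv-unique : 0ℚ < a → b * a ≡ 1ℚ → b ≡ inv a
inv-unique {a} {b} 0<a ba≡1 = begin
  b                ≡⟨ sym (*-identityʳ b) ⟩
  b * 1ℚ           ≡⟨ cong (b *_) (sym (trans (*-comm a (inv a)) (inv-inverseˡ 0<a))) ⟩
  b * (a * inv a)  ≡⟨ sym (*-assoc b a (inv a)) ⟩
  b * a * inv a    ≡⟨ cong (_* inv a) ba≡1 ⟩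
  1ℚ * inv a       ≡⟨ *-identityˡ _ ⟩
  inv a            ∎
  where open ≡-Reasoning

0<inv : 0ℚ < a → 0ℚ < inv a
0<inv {a} 0<a = ≰⇒> λ inv≤0 → <-irrefl refl (<-≤-trans 0<1 (begin
  1ℚ          ≡⟨ sym (inv-inverseˡ 0<a) ⟩
  inv a * a   ≤⟨ *-monoˡ-≤ (<⇒≤ 0<a) inv≤0 ⟩
  0ℚ * a      ≡⟨ *-zeroˡ a ⟩
  0ℚ          ∎))
  where open ≤-Reasoning

inv-antimono : 0ℚ < a → a ≤ b → inv b ≤ inv a
inv-antimono {a} {b} 0<a a≤b = begin
  inv b                  ≡⟨ sym (*-identityˡ _) ⟩
  1ℚ * inv b             ≡⟨ cong (_* inv b) (sym (inv-inverseˡ 0<a)) ⟩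
  inv a * a * inv b      ≤⟨ *-monoˡ-≤ (<⇒≤ (0<inv 0<b)) (*-monoʳ-≤ (<⇒≤ (0<inv 0<a)) a≤b) ⟩
  inv a * b * inv b      ≡⟨ *-assoc (inv a) b (inv b) ⟩
  inv a * (b * inv b)    ≡⟨ cong (inv a *_) (trans (*-comm b _) (inv-inverseˡ 0<b)) ⟩
  inv a * 1ℚ             ≡⟨ *-identityʳ _ ⟩
  inv a                  ∎
  where
  open ≤-Reasoning
  0<b = <-≤-trans 0<a a≤b

-- Finite sums and indicators

ind : Bool → ℚ
ind true  = 1ℚ
ind false = 0ℚ

0≤ind : ∀ b → 0ℚ ≤ ind b
0≤ind true  = 0≤1
0≤ind false = ≤-refl

ind≤1 : ∀ b → ind b ≤ 1ℚ
ind≤1 true  = ≤-refl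
ind≤1 false = 0≤1

ind-∧ : ∀ x y → ind (x ∧ y) ≡ ind x * ind y
ind-∧ true  y = sym (*-identityˡ (ind y))
ind-∧ false y = sym (*-zeroˡ (ind y))

ind-*-mono : ∀ b {x y} → (b ≡ true → x ≤ y) → ind b * x ≤ ind b * y
ind-*-mono true  h = *-monoʳ-≤ 0≤1 (h refl)
ind-*-mono false {x} {y} h = ≤-reflexive (trans (*-zeroˡ x) (sym (*-zeroˡ y)))

ind-* : ∀ b {x y} → (b ≡ true → x ≤ y) → 0ℚ ≤ y → ind b * x ≤ y
ind-* true  {x} h _ = ≤-trans (≤-reflexive (*-identityˡ x)) (h refl)
ind-* false {x} _ 0≤y = ≤-trans (≤-reflexive (*-zeroˡ x)) 0≤y

sum-cong : {f g : Fin n → ℚ} → (∀ i → f i ≡ g i) → sumFin f ≡ sumFin g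
sum-cong {n = zero}  h = refl
sum-cong {n = suc n} h = cong₂ _+_ (h Fin.zero) (sum-cong (h ∘ Fin.suc))

sum-mono : {f g : Fin n → ℚ} → (∀ i → f i ≤ g i) → sumFin f ≤ sumFin g
sum-mono {n = zero}  h = ≤-refl
sum-mono {n = suc n} h = +-mono-≤ (h Fin.zero) (sum-mono (h ∘ Fin.suc))

sum-0 : ∀ n → sumFin {n} (λ _ → 0ℚ) ≡ 0ℚ
sum-0 zero    = refl
sum-0 (suc n) = trans (+-identityˡ _) (sum-0 n)

0≤sum : {f : Fin n → ℚ} → (∀ i → 0ℚ ≤ f i) → 0ℚ ≤ sumFin f
0≤sum {n = n} h = ≤-trans (≤-reflexive (sym (sum-0 n))) (sum-mono h)

sum-+ : (f g : Fin n → ℚ) → sumFin (λ i → f i + g i) ≡ sumFin f + sumFin g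
sum-+ {n = zero}  f g = refl
sum-+ {n = suc n} f g = trans (cong ((f Fin.zero + g Fin.zero) +_) (sum-+ (f ∘ Fin.suc) (g ∘ Fin.suc)))
  (solve 4 (λ a b c d → a :+ b :+ (c :+ d) := a :+ c :+ (b :+ d)) refl (f Fin.zero) (g Fin.zero) _ _)
  where open +-*-Solver

sum-*ˡ : ∀ c (f : Fin n → ℚ) → sumFin (λ i → c * f i) ≡ c * sumFin f
sum-*ˡ {n = zero}  c f = sym (*-zeroʳ c)
sum-*ˡ {n = suc n} c f = trans (cong (c * f Fin.zero +_) (sum-*ˡ c (f ∘ Fin.suc)))
  (sym (*-distribˡ-+ c (f Fin.zero) (sumFin (f ∘ Fin.suc))))

sum-*ʳ : ∀ c (f : Fin n → ℚ) → sumFin (λ i → f i * c) ≡ sumFin f * c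
sum-*ʳ c f = trans (sum-cong (λ i → *-comm (f i) c)) (trans (sum-*ˡ c f) (*-comm c _))

sum-swap : (f : Fin m → Fin n → ℚ) →
           sumFin (λ i → sumFin (λ j → f i j)) ≡ sumFin (λ j → sumFin (λ i → f i j))
sum-swap {m = zero}  {n = n} f = sym (sum-0 n)
sum-swap {m = suc m} f = trans (cong (sumFin (f Fin.zero) +_) (sum-swap (f ∘ Fin.suc)))
  (sym (sum-+ (f Fin.zero) (λ j → sumFin (λ i → f (Fin.suc i) j))))

term≤sum : {f : Fin n → ℚ} → (∀ i → 0ℚ ≤ f i) → ∀ i → f i ≤ sumFin f
term≤sum h Fin.zero    = ≤-+ʳ (0≤sum (h ∘ Fin.suc))
term≤sum h (Fin.suc i) = ≤-trans (term≤sum (h ∘ Fin.suc) i) (≤-+ˡ (h Fin.zero))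

-- `sumFin` peels off the first index, whereas `H` and `cum` grow at the last one; this connects the
-- two.
sum-last : (f : ℕ → ℚ) → ∀ T → sumFin {suc T} (λ i → f (toℕ i)) ≡ sumFin {T} (λ i → f (toℕ i)) + f T
sum-last f zero    = +-comm (f 0) 0ℚ
sum-last f (suc T) = trans (cong (f 0 +_) (sum-last (f ∘ suc) T)) (sym (+-assoc (f 0) _ _))

sum-ind-count : (b : Fin n → Bool) → sumFin (λ i → ind (b i)) ≡ ℕ→ℚ (countFin b)
sum-ind-count {n = zero}  b = refl
sum-ind-count {n = suc n} b with b Fin.zero
... | true  = trans (cong (1ℚ +_) (sum-ind-count (b ∘ Fin.suc))) (sym (ℕ→ℚ-suc (countFin (b ∘ Fin.suc))))
... | false = trans (+-identityˡ _) (sum-ind-count (b ∘ Fin.suc))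

-- Once the head is true, exclusivity makes the whole tail vanish. Disjointness enters the estimates
-- below in this form.
sum-exclusive : (b : Fin n → Bool) → (∀ i j → b i ≡ true → b j ≡ true → i ≡ j) →
                sumFin (λ i → ind (b i)) ≤ 1ℚ
sum-exclusive {n = zero}  b h = 0≤1
sum-exclusive {n = suc n} b h with b Fin.zero in eq
... | true  = ≤-reflexive (trans (cong (1ℚ +_) (trans (sum-cong rest) (sum-0 n))) (+-identityʳ 1ℚ))
  where
  rest : ∀ i → ind (b (Fin.suc i)) ≡ 0ℚ
  rest i with b (Fin.suc i) in eq′
  ... | false = refl
  ... | true  with () ← h Fin.zero (Fin.suc i) eq eq′
... | false = ≤-trans (≤-reflexive (+-identityˡ _))
                (sum-exclusive (b ∘ Fin.suc) (λ i j p q → FinP.suc-injective (h _ _ p q)))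

sum-const1 : ∀ T → sumFin {T} (λ _ → 1ℚ) ≡ ℕ→ℚ T
sum-const1 zero    = refl
sum-const1 (suc T) = trans (cong (1ℚ +_) (sum-const1 T)) (sym (ℕ→ℚ-suc T))

H-sum : ∀ m → H m ≡ sumFin {m} (λ i → ℤ.+ 1 / suc (toℕ i))
H-sum zero    = refl
H-sum (suc m) = trans (cong (_+ (ℤ.+ 1 / suc m)) (H-sum m)) (sym (sum-last (λ k → ℤ.+ 1 / suc k) m))

-- Counting

count-mono : {b c : Fin n → Bool} → (∀ i → b i ≡ true → c i ≡ true) → countFin b ℕ.≤ countFin c
count-mono {n = zero}  h = ℕ.z≤n
count-mono {n = suc n} {b} {c} h with b Fin.zero in eb | c Fin.zero in ec
... | true  | true  = ℕ.s≤s (count-mono (h ∘ Fin.suc))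
... | true  | false with () ← trans (sym ec) (h Fin.zero eb)
... | false | true  = ℕP.m≤n⇒m≤1+n (count-mono (h ∘ Fin.suc))
... | false | false = count-mono (h ∘ Fin.suc)

count-mono-< : {b c : Fin n → Bool} → (∀ i → b i ≡ true → c i ≡ true) →
               ∀ i → b i ≡ false → c i ≡ true → countFin b ℕ.< countFin c
count-mono-< h Fin.zero eb ec rewrite eb | ec = ℕ.s≤s (count-mono (h ∘ Fin.suc))
count-mono-< {b = b} {c} h (Fin.suc i) eb ec with b Fin.zero in eb′ | c Fin.zero in ec′
... | true  | true  = ℕ.s≤s (count-mono-< (h ∘ Fin.suc) i eb ec)
... | true  | false with () ← trans (sym ec′) (h Fin.zero eb′)
... | false | true  = ℕP.m≤n⇒m≤1+n (count-mono-< (h ∘ Fin.suc) i eb ec)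
... | false | false = count-mono-< (h ∘ Fin.suc) i eb ec

count-cong : ∀ {n} {b c : Fin n → Bool} → (∀ i → b i ≡ c i) → countFin b ≡ countFin c
count-cong {b = b} {c} h = ℕP.≤-antisym (count-mono (λ i → trans (sym (h i)))) (count-mono (λ i → trans (h i)))

0<count : (b : Fin n → Bool) → ∀ i → b i ≡ true → 0 ℕ.< countFin b
0<count b i h = ℕP.≤-<-trans ℕ.z≤n (count-mono-< {b = λ _ → false} {c = b} (λ _ ()) i refl h)

count≤n : (b : Fin n → Bool) → countFin b ℕ.≤ n
count≤n {n = zero}  b = ℕ.z≤n
count≤n {n = suc n} b with b Fin.zero
... | true  = ℕ.s≤s (count≤n (b ∘ Fin.suc))
... | false = ℕP.m≤n⇒m≤1+n (count≤n (b ∘ Fin.suc))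

-- Harmonic rates along a ranking

-- One slot in isolation. With `f` the front and `π` the keys of that slot, `rank` and `rate` unfold
-- to `position` and `algRate`, so the results apply to the algorithm without conversion.
module Ranking {n : ℕ} (f : Fin n → Bool) (π : Fin n → ℕ) where

  rank : Fin n → ℕ
  rank j = countFin (λ i → f i ∧ ⌊ π i ℕ.≤? π j ⌋)

  rate : Fin n → ℚ
  rate j = if f j then inv (H (countFin f) * ℕ→ℚ (rank j)) else 0ℚ

  rate-front : ∀ {j} → f j ≡ true → rate j ≡ inv (H (countFin f) * ℕ→ℚ (rank j))
  rate-front = if-true

  rate-idle : ∀ {j} → f j ≡ false → rate j ≡ 0ℚ
  rate-idle = if-false

  0<rank : ∀ {j} → f j ≡ true → 0 ℕ.< rank j
  0<rank {j} fj = 0<count _ j (∧-intro fj (⌊⌋-complete (π j ℕ.≤? π j) ℕP.≤-refl))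

  rank-mono : ∀ {i j} → π i ℕ.≤ π j → rank i ℕ.≤ rank j
  rank-mono {i} {j} πi≤πj = count-mono λ k h → ∧-intro (∧-elimˡ h)
    (⌊⌋-complete (π k ℕ.≤? π j) (ℕP.≤-trans (⌊⌋-sound (π k ℕ.≤? π i) (∧-elimʳ {f k} h)) πi≤πj))

  rank-mono-< : ∀ {i j} → f j ≡ true → π i ℕ.< π j → rank i ℕ.< rank j
  rank-mono-< {i} {j} fj πi<πj = count-mono-<
    (λ k h → ∧-intro (∧-elimˡ h) (⌊⌋-complete (π k ℕ.≤? π j)
       (ℕP.≤-trans (⌊⌋-sound (π k ℕ.≤? π i) (∧-elimʳ {f k} h)) (ℕP.<⇒≤ πi<πj))))
    j not-below (∧-intro fj (⌊⌋-complete (π j ℕ.≤? π j) ℕP.≤-refl))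
    where
    not-below : f j ∧ ⌊ π j ℕ.≤? π i ⌋ ≡ false
    not-below rewrite fj with π j ℕ.≤? π i
    ... | yes πj≤πi = contradiction πi<πj (ℕP.≤⇒≯ πj≤πi)
    ... | no  _     = refl

  0<denominator : ∀ {j} → f j ≡ true → 0ℚ < H (countFin f) * ℕ→ℚ (rank j)
  0<denominator {j} fj = 0<* (0<H (0<count f j fj)) (<-≤-trans (0<ℕ→ℚ 0) (ℕ→ℚ-mono (0<rank fj)))

  0≤rate : ∀ j → 0ℚ ≤ rate j
  0≤rate j = case true-or-false (f j) of λ
    { (inj₁ fj) → ≤-trans (<⇒≤ (0<inv (0<denominator fj))) (≤-reflexive (sym (rate-front fj)))
    ; (inj₂ fj) → ≤-reflexive (sym (rate-idle fj)) }

  rate-inverse : ∀ {j} → f j ≡ true → rate j * (H (countFin f) * ℕ→ℚ (rank j)) ≡ 1ℚ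
  rate-inverse {j} fj = trans (cong (_* (H (countFin f) * ℕ→ℚ (rank j))) (rate-front fj))
                              (inv-inverseˡ (0<denominator fj))

  rate-antimono : ∀ {i j} → f i ≡ true → f j ≡ true → π i ℕ.≤ π j → rate j ≤ rate i
  rate-antimono {i} {j} fi fj πi≤πj = ≤-trans (≤-reflexive (rate-front fj))
    (≤-trans (inv-antimono (0<denominator fi)
                (*-monoʳ-≤ (0≤H (countFin f)) (ℕ→ℚ-mono (rank-mono πi≤πj))))
             (≤-reflexive (sym (rate-front fi))))

  -- A front job has rate at least 1 / (H_n n), because neither the size of the front nor the rank
  -- exceeds `n`. This guaranteed progress makes the run terminate.
  ind≤rate : ∀ j → ind (f j) ≤ H n * ℕ→ℚ n * rate j
  ind≤rate j = case true-or-false (f j) of λ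
    { (inj₁ fj) → begin
        ind (f j)                                     ≡⟨ cong ind fj ⟩
        1ℚ                                            ≡⟨ sym (rate-inverse fj) ⟩
        rate j * (H (countFin f) * ℕ→ℚ (rank j))      ≡⟨ *-comm (rate j) (H (countFin f) * ℕ→ℚ (rank j)) ⟩
        H (countFin f) * ℕ→ℚ (rank j) * rate j        ≤⟨ *-monoˡ-≤ (0≤rate j) (≤-trans
                                                           (*-monoˡ-≤ (0≤ℕ→ℚ (rank j)) (H-mono (count≤n f)))
                                                           (*-monoʳ-≤ (0≤H n) (ℕ→ℚ-mono (count≤n (λ i → f i ∧ ⌊ π i ℕ.≤? π j ⌋))))) ⟩
        H n * ℕ→ℚ n * rate j                          ∎
    ; (inj₂ fj) → ≤-trans (≤-reflexive (cong ind fj)) (0≤* (0≤* (0≤H n) (0≤ℕ→ℚ n)) (0≤rate j)) }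
    where open ≤-Reasoning

  module _ (π-injective : ∀ i j → π i ≡ π j → i ≡ j) where

    rank-injective : ∀ {i j} → f i ≡ true → f j ≡ true → rank i ≡ rank j → i ≡ j
    rank-injective {i} {j} fi fj eq with ℕP.<-cmp (π i) (π j)
    ... | tri< πi<πj _ _ = contradiction (rank-mono-< fj πi<πj) (ℕP.<-irrefl eq)
    ... | tri≈ _ πi≡πj _ = π-injective i j πi≡πj
    ... | tri> _ _ πj<πi = contradiction (rank-mono-< fi πj<πi) (ℕP.<-irrefl (sym eq))

    -- The ranks of front jobs are distinct numbers from 1 to |F|, so the rates are distinct terms
    -- of the sum of 1 / (H_|F| k), whose total is 1. A double sum over jobs and ranks takes the
    -- place of reindexing along a bijection.
    sum-rate≤1 : sumFin rate ≤ 1ℚ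
    sum-rate≤1 = begin
      sumFin rate
        ≤⟨ sum-mono rate≤ ⟩
      sumFin (λ j → h * sumFin (λ k → ind (hasRank j k) * u k))
        ≡⟨ sum-*ˡ h (λ j → sumFin (λ k → ind (hasRank j k) * u k)) ⟩
      h * sumFin (λ j → sumFin (λ k → ind (hasRank j k) * u k))
        ≡⟨ cong (h *_) (sum-swap (λ j k → ind (hasRank j k) * u k)) ⟩
      h * sumFin (λ k → sumFin (λ j → ind (hasRank j k) * u k))
        ≤⟨ *-monoʳ-≤ 0≤h (sum-mono λ k → begin
             sumFin (λ j → ind (hasRank j k) * u k)  ≡⟨ sum-*ʳ (u k) (λ j → ind (hasRank j k)) ⟩
             sumFin (λ j → ind (hasRank j k)) * u k  ≤⟨ *-monoˡ-≤ (0≤1/ (toℕ k)) (sum-exclusive (λ j → hasRank j k) (exclusive k)) ⟩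
             1ℚ * u k                                ≡⟨ *-identityˡ (u k) ⟩
             u k                                     ∎) ⟩
      h * sumFin u
        ≡⟨ cong (h *_) (sym (H-sum (countFin f))) ⟩
      h * H (countFin f)
        ≤⟨ invH*H≤1 (countFin f) ⟩
      1ℚ ∎
      where
      open ≤-Reasoning
      h = inv (H (countFin f))
      u : Fin (countFin f) → ℚ
      u k = ℤ.+ 1 / suc (toℕ k)
      hasRank : Fin n → Fin (countFin f) → Bool
      hasRank j k = f j ∧ ⌊ rank j ℕ.≟ suc (toℕ k) ⌋
      0≤invH : ∀ m → 0ℚ ≤ inv (H m)
      -- For an empty front, `H` is 0 and `inv` returns its default value 0.
      0≤invH zero    = ≤-refl
      0≤invH (suc m) = <⇒≤ (0<inv (0<H {suc m} (ℕ.s≤s ℕ.z≤n)))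
      invH*H≤1 : ∀ m → inv (H m) * H m ≤ 1ℚ
      invH*H≤1 zero    = ≤-trans (≤-reflexive (*-zeroʳ (inv 0ℚ))) 0≤1
      invH*H≤1 (suc m) = ≤-reflexive (inv-inverseˡ (0<H {suc m} (ℕ.s≤s ℕ.z≤n)))
      0≤h = 0≤invH (countFin f)
      0≤terms : ∀ j k → 0ℚ ≤ ind (hasRank j k) * u k
      0≤terms j k = 0≤* (0≤ind (hasRank j k)) (0≤1/ (toℕ k))
      exclusive : ∀ k i j → hasRank i k ≡ true → hasRank j k ≡ true → i ≡ j
      exclusive k i j hi hj = rank-injective (∧-elimˡ hi) (∧-elimˡ hj)
        (trans (⌊⌋-sound (rank i ℕ.≟ _) (∧-elimʳ {f i} hi)) (sym (⌊⌋-sound (rank j ℕ.≟ _) (∧-elimʳ {f j} hj))))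
      rate≤ : ∀ j → rate j ≤ h * sumFin (λ k → ind (hasRank j k) * u k)
      rate≤ j = case true-or-false (f j) of λ
        { (inj₁ fj) → rate≤-front fj
        ; (inj₂ fj) → ≤-trans (≤-reflexive (rate-idle fj)) (0≤* 0≤h (0≤sum (0≤terms j))) }
        where
        Hf = H (countFin f)
        rank-suc : f j ≡ true → ∃ λ k → rank j ≡ suc k × k ℕ.< countFin f
        rank-suc fj with rank j | 0<rank fj | count-mono {b = λ i → f i ∧ ⌊ π i ℕ.≤? π j ⌋} {c = f} (λ i → ∧-elimˡ)
        ... | suc k | _ | k<m = k , refl , k<m
        u≤sum : f j ≡ true → ∀ k → rank j ≡ suc (toℕ k) → u k ≤ sumFin (λ k → ind (hasRank j k) * u k)
        u≤sum fj k eq = ≤-trans (≤-reflexive (sym (trans (cong (λ x → ind x * u k)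
          (∧-intro fj (⌊⌋-complete (rank j ℕ.≟ suc (toℕ k)) eq))) (*-identityˡ (u k))))) (term≤sum (0≤terms j) k)
        product≡1 : 0ℚ < Hf → ∀ k → h * (ℤ.+ 1 / suc k) * (Hf * ℕ→ℚ (suc k)) ≡ 1ℚ
        product≡1 0<Hf k = trans (solve 4 (λ h u H k → h :* u :* (H :* k) := h :* H :* (k :* u)) refl h (ℤ.+ 1 / suc k) Hf (ℕ→ℚ (suc k)))
          (trans (cong₂ _*_ (inv-inverseˡ 0<Hf) (ℕ→ℚ-*-1/ k)) (*-identityˡ 1ℚ))
          where open +-*-Solver
        rate≤-front : f j ≡ true → rate j ≤ h * sumFin (λ k → ind (hasRank j k) * u k)
        rate≤-front fj = let k , rj , k<m = rank-suc fj
                             0<Hf = 0<H (0<count f j fj) in begin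
          rate j                   ≡⟨ rate-front fj ⟩
          inv (Hf * ℕ→ℚ (rank j))  ≡⟨ cong (λ r → inv (Hf * ℕ→ℚ r)) rj ⟩
          inv (Hf * ℕ→ℚ (suc k))   ≡⟨ sym (inv-unique (0<* 0<Hf (0<ℕ→ℚ k)) (product≡1 0<Hf k)) ⟩
          h * (ℤ.+ 1 / suc k)      ≡⟨ cong (λ l → h * (ℤ.+ 1 / suc l)) (sym (FinP.toℕ-fromℕ< k<m)) ⟩
          h * u (Fin.fromℕ< k<m)   ≤⟨ *-monoʳ-≤ 0≤h (u≤sum fj (Fin.fromℕ< k<m)
                                        (trans rj (cong suc (sym (FinP.toℕ-fromℕ< k<m))))) ⟩
          h * sumFin (λ k → ind (hasRank j k) * u k)  ∎

-- The rates depend on the completion times only through the front; the slot by slot construction of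
-- a run relies on this.
rate-cong : ∀ {n} {f f′ : Fin n → Bool} (π : Fin n → ℕ) → (∀ i → f i ≡ f′ i) →
            ∀ j → Ranking.rate f π j ≡ Ranking.rate f′ π j
rate-cong {f = f} {f′} π f≡f′ j = trans (cong (λ b → if b then inv (H (countFin f) * ℕ→ℚ (Ranking.rank f π j)) else 0ℚ) (f≡f′ j))
  (cong₂ (λ k l → if f′ j then inv (H k * ℕ→ℚ l) else 0ℚ) (count-cong f≡f′)
    (count-cong (λ i → cong (_∧ ⌊ π i ℕ.≤? π j ⌋) (f≡f′ i))))

-- Charging pairs of front jobs

-- The minimum of `r i * x j` and `r j * x i` is expressed as a disjunction: by `charge`, at least
-- one of the two products is paid for by the matching value of `G`. In the application `h` is the
-- harmonic number of the size of the front.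
module PairCharging
  {n : ℕ} (f : Fin n → Bool) (π : Fin n → ℕ) (π-injective : ∀ i j → π i ≡ π j → i ≡ j)
  (h : ℚ) (0≤h : 0ℚ ≤ h)
  (r : Fin n → ℚ) (0≤r : ∀ j → 0ℚ ≤ r j)
  (r-inverse : ∀ {j} → f j ≡ true → r j * (h * ℕ→ℚ (Ranking.rank f π j)) ≡ 1ℚ)
  (r-antimono : ∀ {i j} → f i ≡ true → f j ≡ true → π i ℕ.≤ π j → r j ≤ r i)
  (x : Fin n → ℚ) (0≤x : ∀ j → 0ℚ ≤ x j)
  (ε : ℚ) (0<ε : 0ℚ < ε) (L : ℕ)
  (misplaced≤L : ∀ {j} → f j ≡ true →
     countFin (λ i → f i ∧ ⌊ (1ℚ + ε) * x i ≤? x j ⌋ ∧ ⌊ π i ℕ.≤? π j ⌋) ℕ.≤ L)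
  (G : Fin n → Fin n → ℚ) (0≤G : ∀ i j → 0ℚ ≤ G i j)
  (charge : ∀ i j → f i ≡ true → f j ≡ true → r i * x j ≤ G i j ⊎ r j * x i ≤ G j i)
  where

  open Ranking f π using (rank)

  -- The factor is doubled because the diagonal pair of a job pays twice: for the job itself, with 1
  -- ≤ `M`, and for its misplaced jobs, with `ℕ→ℚ L` ≤ `M`.
  M K : ℚ
  M = (1ℚ + ε) ⊔ ℕ→ℚ L
  K = M + M

  1≤M : 1ℚ ≤ M
  1≤M = ≤-trans (≤-+ʳ (<⇒≤ 0<ε)) (p≤p⊔q (1ℚ + ε) (ℕ→ℚ L))

  0≤M : 0ℚ ≤ M
  0≤M = ≤-trans 0≤1 1≤M

  0≤K : 0ℚ ≤ K
  0≤K = 0≤+ 0≤M 0≤M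

  g : Fin n → Fin n → ℚ
  g i j = ind (f i) * ind (f j) * G i j

  0≤g : ∀ i j → 0ℚ ≤ g i j
  0≤g i j = 0≤* (0≤* (0≤ind (f i)) (0≤ind (f j))) (0≤G i j)

  g-front : ∀ {i j} → f i ≡ true → f j ≡ true → g i j ≡ G i j
  g-front {i} {j} fi fj = trans (cong₂ (λ a b → ind a * ind b * G i j) fi fj)
    (solve 1 (λ G → con 1ℚ :* con 1ℚ :* G := G) refl (G i j))
    where open +-*-Solver

  -- The payment of the unordered pair of `i` and `j`, credited to whichever is ranked later. The
  -- strict comparison in the second summand prevents the diagonal from counting twice.
  Q : Fin n → Fin n → ℚ
  Q i j = ind ⌊ π i ℕ.≤? π j ⌋ * g i j + ind ⌊ π i ℕ.<? π j ⌋ * g j i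

  0≤Q₁ : ∀ i j → 0ℚ ≤ ind ⌊ π i ℕ.≤? π j ⌋ * g i j
  0≤Q₁ i j = 0≤* (0≤ind ⌊ π i ℕ.≤? π j ⌋) (0≤g i j)

  0≤Q₂ : ∀ i j → 0ℚ ≤ ind ⌊ π i ℕ.<? π j ⌋ * g j i
  0≤Q₂ i j = 0≤* (0≤ind ⌊ π i ℕ.<? π j ⌋) (0≤g j i)

  0≤Q : ∀ i j → 0ℚ ≤ Q i j
  0≤Q i j = 0≤+ (0≤Q₁ i j) (0≤Q₂ i j)

  G≤Q : ∀ {i j} → f i ≡ true → f j ≡ true → π i ℕ.≤ π j → G i j ≤ Q i j
  G≤Q {i} {j} fi fj πi≤πj = ≤-trans (≤-reflexive (sym
    (trans (cong (λ b → ind b * g i j) (⌊⌋-complete (π i ℕ.≤? π j) πi≤πj)) (trans (*-identityˡ (g i j)) (g-front fi fj)))))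
    (≤-+ʳ (0≤Q₂ i j))

  G≤Q′ : ∀ {i j} → f i ≡ true → f j ≡ true → π i ℕ.< π j → G j i ≤ Q i j
  G≤Q′ {i} {j} fi fj πi<πj = ≤-trans (≤-reflexive (sym
    (trans (cong (λ b → ind b * g j i) (⌊⌋-complete (π i ℕ.<? π j) πi<πj)) (trans (*-identityˡ (g j i)) (g-front fj fi)))))
    (≤-+ˡ (0≤Q₁ i j))

  module _ {j : Fin n} (fj : f j ≡ true) where

    private
      z : ℚ
      z = r j * x j
      0≤z : 0ℚ ≤ z
      0≤z = 0≤* (0≤r j) (0≤x j)
      ahead misplaced : Fin n → Bool
      ahead i = f i ∧ ⌊ π i ℕ.≤? π j ⌋
      misplaced i = f i ∧ ⌊ (1ℚ + ε) * x i ≤? x j ⌋ ∧ ⌊ π i ℕ.≤? π j ⌋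

    -- If the pair pays for `r i * x j`, this suffices because `i` is ranked ahead and runs at least
    -- as fast as `j`. If it pays for `r j * x i`, then `x j` exceeds `x i` by a factor less than
    -- `1ℚ + ε`.
    z≤MQ : ∀ {i} → f i ≡ true → π i ℕ.< π j → ¬ (1ℚ + ε) * x i ≤ x j → z ≤ M * Q i j
    z≤MQ {i} fi πi<πj ¬small = case charge i j fi fj of λ
      { (inj₁ ri*xj≤G) → begin
          r j * x j     ≤⟨ *-monoˡ-≤ (0≤x j) (r-antimono fi fj (ℕP.<⇒≤ πi<πj)) ⟩
          r i * x j     ≤⟨ ri*xj≤G ⟩
          G i j         ≤⟨ G≤Q fi fj (ℕP.<⇒≤ πi<πj) ⟩
          Q i j         ≡⟨ sym (*-identityˡ (Q i j)) ⟩
          1ℚ * Q i j    ≤⟨ *-monoˡ-≤ (0≤Q i j) 1≤M ⟩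
          M * Q i j     ∎
      ; (inj₂ rj*xi≤G) → begin
          r j * x j               ≤⟨ *-monoʳ-≤ (0≤r j) (<⇒≤ (≰⇒> ¬small)) ⟩
          r j * ((1ℚ + ε) * x i)  ≡⟨ solve 3 (λ r e x → r :* (e :* x) := e :* (r :* x)) refl (r j) (1ℚ + ε) (x i) ⟩
          (1ℚ + ε) * (r j * x i)  ≤⟨ *-monoˡ-≤ (0≤* (0≤r j) (0≤x i)) (p≤p⊔q (1ℚ + ε) (ℕ→ℚ L)) ⟩
          M * (r j * x i)         ≤⟨ *-monoʳ-≤ 0≤M (≤-trans rj*xi≤G (G≤Q′ fi fj πi<πj)) ⟩
          M * Q i j               ∎ }
      where
      open ≤-Reasoning
      open +-*-Solver

    -- Misplaced jobs are not charged to `Q` but carried along on the right. The allowance of `L`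
    -- placed on the diagonal `i = j` cancels them after summation over `i`.
    charge-pair : ∀ i → z * (ind (ahead i) + ℕ→ℚ L * ind ⌊ i FinP.≟ j ⌋) ≤ K * Q i j + z * ind (misplaced i)
    charge-pair i = case i FinP.≟ j of λ
      { (yes refl) → begin
          z * (ind (ahead j) + ℕ→ℚ L * ind ⌊ j FinP.≟ j ⌋)
            ≡⟨ cong₂ (λ a b → z * (ind a + ℕ→ℚ L * ind b)) (∧-intro fj (⌊⌋-complete (π j ℕ.≤? π j) ℕP.≤-refl)) (⌊⌋-complete (j FinP.≟ j) refl) ⟩
          z * (1ℚ + ℕ→ℚ L * 1ℚ)
            ≤⟨ *-monoʳ-≤ 0≤z (+-mono-≤ 1≤M (≤-trans (≤-reflexive (*-identityʳ (ℕ→ℚ L))) (p≤q⊔p (1ℚ + ε) (ℕ→ℚ L)))) ⟩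
          z * K
            ≡⟨ *-comm z K ⟩
          K * z
            ≤⟨ *-monoʳ-≤ 0≤K (≤-trans (case charge j j fj fj of λ { (inj₁ c) → c ; (inj₂ c) → c }) (G≤Q fj fj ℕP.≤-refl)) ⟩
          K * Q j j
            ≤⟨ ≤-+ʳ (0≤* 0≤z (0≤ind (misplaced j))) ⟩
          K * Q j j + z * ind (misplaced j) ∎
      ; (no i≢j) → begin
          z * (ind (ahead i) + ℕ→ℚ L * ind ⌊ i FinP.≟ j ⌋)
            ≡⟨ cong (λ b → z * (ind (ahead i) + ℕ→ℚ L * ind b)) (⌊⌋-refute (i FinP.≟ j) i≢j) ⟩
          z * (ind (ahead i) + ℕ→ℚ L * 0ℚ)
            ≡⟨ solve 3 (λ z a l → z :* (a :+ l :* con 0ℚ) := z :* a) refl z (ind (ahead i)) (ℕ→ℚ L) ⟩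
          z * ind (ahead i)
            ≤⟨ off-diagonal i≢j ⟩
          K * Q i j + z * ind (misplaced i) ∎ }
      where
      open ≤-Reasoning
      open +-*-Solver
      0≤KQ : 0ℚ ≤ K * Q i j
      0≤KQ = 0≤* 0≤K (0≤Q i j)
      off-diagonal : i ≢ j → z * ind (ahead i) ≤ K * Q i j + z * ind (misplaced i)
      off-diagonal i≢j = case true-or-false (ahead i) of λ
        { (inj₂ ¬ahead) → ≤-trans (≤-reflexive (trans (cong (λ b → z * ind b) ¬ahead) (*-zeroʳ z)))
            (0≤+ 0≤KQ (0≤* 0≤z (0≤ind (misplaced i))))
        ; (inj₁ isAhead) → case (1ℚ + ε) * x i ≤? x j of λ
            { (yes small) → ≤-trans (≤-reflexive (cong (λ b → z * ind b)
                (trans isAhead (sym (∧-intro (∧-elimˡ {f i} isAhead) (∧-intro (⌊⌋-complete ((1ℚ + ε) * x i ≤? x j) small) (∧-elimʳ {f i} isAhead)))))))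
                (≤-+ˡ 0≤KQ)
            ; (no ¬small) → begin
                z * ind (ahead i)
                  ≡⟨ trans (cong (λ b → z * ind b) isAhead) (*-identityʳ z) ⟩
                z
                  ≤⟨ z≤MQ (∧-elimˡ {f i} isAhead) (ℕP.≤∧≢⇒< (⌊⌋-sound (π i ℕ.≤? π j) (∧-elimʳ {f i} isAhead)) (i≢j ∘ π-injective i j)) ¬small ⟩
                M * Q i j
                  ≤⟨ ≤-+ʳ (0≤* 0≤M (0≤Q i j)) ⟩
                M * Q i j + M * Q i j
                  ≡⟨ sym (*-distribʳ-+ (Q i j) M M) ⟩
                K * Q i j
                  ≤⟨ ≤-+ʳ (0≤* 0≤z (0≤ind (misplaced i))) ⟩
                K * Q i j + z * ind (misplaced i) ∎ } }

    -- As `r j` is the inverse of `h` times the rank, `x j` is `h` times one copy of `z` for each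
    -- job ranked up to `j`; each copy is charged to the pair of that job and `j`.
    charge-job : x j ≤ h * (K * sumFin (λ i → Q i j))
    charge-job = begin
      x j
        ≡⟨ sym (*-identityˡ (x j)) ⟩
      1ℚ * x j
        ≡⟨ cong (_* x j) (sym (r-inverse fj)) ⟩
      r j * (h * ℕ→ℚ (rank j)) * x j
        ≡⟨ solve 4 (λ r h k x → r :* (h :* k) :* x := h :* (r :* x :* k)) refl (r j) h (ℕ→ℚ (rank j)) (x j) ⟩
      h * (z * ℕ→ℚ (rank j))
        ≤⟨ *-monoʳ-≤ 0≤h (+-cancel-≤ {d = z * ℕ→ℚ (countFin misplaced)} summed (*-monoʳ-≤ 0≤z (ℕ→ℚ-mono (misplaced≤L fj)))) ⟩
      h * (K * sumFin (λ i → Q i j)) ∎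
      where
      open ≤-Reasoning
      open +-*-Solver
      is-j : Fin n → ℚ
      is-j i = ind ⌊ i FinP.≟ j ⌋
      1≤Σis-j : 1ℚ ≤ sumFin is-j
      1≤Σis-j = ≤-trans (≤-reflexive (cong ind (sym (⌊⌋-complete (j FinP.≟ j) refl))))
                  (term≤sum {f = is-j} (λ i → 0≤ind ⌊ i FinP.≟ j ⌋) j)
      summed : z * ℕ→ℚ (rank j) + z * ℕ→ℚ L ≤ K * sumFin (λ i → Q i j) + z * ℕ→ℚ (countFin misplaced)
      summed = begin
        z * ℕ→ℚ (rank j) + z * ℕ→ℚ L
          ≡⟨ solve 3 (λ z k l → z :* k :+ z :* l := z :* (k :+ l :* con 1ℚ)) refl z (ℕ→ℚ (rank j)) (ℕ→ℚ L) ⟩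
        z * (ℕ→ℚ (rank j) + ℕ→ℚ L * 1ℚ)
          ≤⟨ *-monoʳ-≤ 0≤z (+-mono-≤ (≤-reflexive (sym (sum-ind-count ahead))) (*-monoʳ-≤ (0≤ℕ→ℚ L) 1≤Σis-j)) ⟩
        z * (sumFin (λ i → ind (ahead i)) + ℕ→ℚ L * sumFin is-j)
          ≡⟨ cong (λ s → z * (sumFin (λ i → ind (ahead i)) + s)) (sym (sum-*ˡ (ℕ→ℚ L) is-j)) ⟩
        z * (sumFin (λ i → ind (ahead i)) + sumFin (λ i → ℕ→ℚ L * is-j i))
          ≡⟨ cong (z *_) (sym (sum-+ (λ i → ind (ahead i)) (λ i → ℕ→ℚ L * is-j i))) ⟩
        z * sumFin (λ i → ind (ahead i) + ℕ→ℚ L * is-j i)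
          ≡⟨ sym (sum-*ˡ z (λ i → ind (ahead i) + ℕ→ℚ L * is-j i)) ⟩
        sumFin (λ i → z * (ind (ahead i) + ℕ→ℚ L * is-j i))
          ≤⟨ sum-mono charge-pair ⟩
        sumFin (λ i → K * Q i j + z * ind (misplaced i))
          ≡⟨ sum-+ (λ i → K * Q i j) (λ i → z * ind (misplaced i)) ⟩
        sumFin (λ i → K * Q i j) + sumFin (λ i → z * ind (misplaced i))
          ≡⟨ cong₂ _+_ (sum-*ˡ K (λ i → Q i j)) (trans (sum-*ˡ z (λ i → ind (misplaced i))) (cong (z *_) (sum-ind-count misplaced))) ⟩
        K * sumFin (λ i → Q i j) + z * ℕ→ℚ (countFin misplaced) ∎

  charge-all : sumFin (λ j → ind (f j) * x j) ≤ h * K * sumFin (λ i → sumFin (λ j → g i j))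
  charge-all = begin
    sumFin (λ j → ind (f j) * x j)
      ≤⟨ sum-mono charge-front ⟩
    sumFin (λ j → h * K * sumFin (λ i → Q i j))
      ≡⟨ sum-*ˡ (h * K) (λ j → sumFin (λ i → Q i j)) ⟩
    h * K * sumFin (λ j → sumFin (λ i → Q i j))
      ≤⟨ *-monoʳ-≤ (0≤* 0≤h 0≤K) ΣQ≤Σg ⟩
    h * K * sumFin (λ i → sumFin (λ j → g i j)) ∎
    where
    open ≤-Reasoning
    charge-front : ∀ j → ind (f j) * x j ≤ h * K * sumFin (λ i → Q i j)
    charge-front j = case true-or-false (f j) of λ
      { (inj₁ fj) → ≤-trans (≤-reflexive (trans (cong (λ b → ind b * x j) fj) (*-identityˡ (x j))))
          (≤-trans (charge-job fj) (≤-reflexive (sym (*-assoc h K (sumFin (λ i → Q i j))))))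
      ; (inj₂ fj) → ≤-trans (≤-reflexive (trans (cong (λ b → ind b * x j) fj) (*-zeroˡ (x j))))
          (0≤* (0≤* 0≤h 0≤K) (0≤sum (λ i → 0≤Q i j))) }
    le lt : Fin n → Fin n → ℚ
    le i j = ind ⌊ π i ℕ.≤? π j ⌋
    lt i j = ind ⌊ π i ℕ.<? π j ⌋
    -- The payment `g i j` occurs in `Q i j` or in `Q j i`, but never in both.
    le+lt≤1 : ∀ i j → le i j + lt j i ≤ 1ℚ
    le+lt≤1 i j with π i ℕ.≤? π j | π j ℕ.<? π i
    ... | yes p | yes q = contradiction q (ℕP.≤⇒≯ p)
    ... | yes _ | no  _ = ≤-refl
    ... | no  _ | yes _ = ≤-refl
    ... | no  _ | no  _ = 0≤1
    ΣQ≤Σg : sumFin (λ j → sumFin (λ i → Q i j)) ≤ sumFin (λ i → sumFin (λ j → g i j))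
    ΣQ≤Σg = begin
      sumFin (λ j → sumFin (λ i → le i j * g i j + lt i j * g j i))
        ≡⟨ trans (sum-cong (λ j → sum-+ (λ i → le i j * g i j) (λ i → lt i j * g j i)))
                 (sum-+ (λ j → sumFin (λ i → le i j * g i j)) (λ j → sumFin (λ i → lt i j * g j i))) ⟩
      sumFin (λ j → sumFin (λ i → le i j * g i j)) + sumFin (λ i → sumFin (λ j → lt j i * g i j))
        ≡⟨ cong (_+ sumFin (λ i → sumFin (λ j → lt j i * g i j))) (sum-swap (λ j i → le i j * g i j)) ⟩
      sumFin (λ i → sumFin (λ j → le i j * g i j)) + sumFin (λ i → sumFin (λ j → lt j i * g i j))
        ≡⟨ sym (trans (sum-cong (λ i → sum-+ (λ j → le i j * g i j) (λ j → lt j i * g i j)))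
                 (sum-+ (λ i → sumFin (λ j → le i j * g i j)) (λ i → sumFin (λ j → lt j i * g i j)))) ⟩
      sumFin (λ i → sumFin (λ j → le i j * g i j + lt j i * g i j))
        ≤⟨ sum-mono (λ i → sum-mono (λ j → begin
             le i j * g i j + lt j i * g i j  ≡⟨ sym (*-distribʳ-+ (g i j) (le i j) (lt j i)) ⟩
             (le i j + lt j i) * g i j        ≤⟨ *-monoˡ-≤ (0≤g i j) (le+lt≤1 i j) ⟩
             1ℚ * g i j                       ≡⟨ *-identityˡ (g i j) ⟩
             g i j                            ∎)) ⟩
      sumFin (λ i → sumFin (λ j → g i j)) ∎

-- Forests and fronts

-- The fuelled search inside `inS` is local to its definition.  With the fuel
-- and the size of the forest abstracted to distinct variables, unification
-- recovers it, which makes induction on the fuel possible.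
mutual
  search : ∀ {n} → Forest n → Fin n → Fin n → ℕ → Bool
  search = _

  search-spec : ∀ m (par : Forest (suc m)) v u → anc par (suc m) u ≡ nothing →
                inS par v u ≡ search par v u m
  search-spec m par v u h with anc par m u >>= par
  ... | just _ with () ← h
  ... | nothing with suc m
  ... | _ = refl

module _ {n : ℕ} (par : Forest n) where

  anc-+ : ∀ i j u → anc par (j ℕ.+ i) u ≡ (anc par i u >>= anc par j)
  anc-+ i zero u with anc par i u
  ... | just _  = refl
  ... | nothing = refl
  anc-+ i (suc j) u rewrite anc-+ i j u with anc par i u
  ... | just _  = refl
  ... | nothing = refl

  anc-trans : ∀ {i j u v r} → anc par i u ≡ just v → anc par j v ≡ r → anc par (j ℕ.+ i) u ≡ r
  anc-trans {i} {j} {u} h refl = trans (anc-+ i j u) (cong (_>>= anc par j) h)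

  anc-∸ : ∀ {i k u v r} → i ℕ.≤ k → anc par i u ≡ just v → anc par k u ≡ r → anc par (k ℕ.∸ i) v ≡ r
  anc-∸ {i} {k} {u} i≤k h h′ = trans (sym (anc-trans {i} {k ℕ.∸ i} h refl))
    (trans (cong (λ l → anc par l u) (ℕP.m∸n+n≡m i≤k)) h′)

  anc-< : ∀ {i k u v v′} → i ℕ.< k → anc par i u ≡ just v → anc par k u ≡ just v′ → ProperPred par v′ v
  anc-< {i} {k} i<k h h′ with k ℕ.∸ i | ℕP.m<n⇒0<n∸m i<k | anc-∸ (ℕP.<⇒≤ i<k) h h′
  ... | suc d | _ | eq = d , eq

  anc-comparable : ∀ {i j u v v′} → anc par i u ≡ just v → anc par j u ≡ just v′ →
                   v ≡ v′ ⊎ (ProperPred par v′ v ⊎ ProperPred par v v′)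
  anc-comparable {i} {j} h h′ with ℕP.<-cmp i j
  ... | tri< i<j _ _ = inj₂ (inj₁ (anc-< i<j h h′))
  ... | tri≈ _ refl _ = inj₁ (just-injective (trans (sym h) h′))
  ... | tri> _ _ j<i = inj₂ (inj₂ (anc-< j<i h′ h))

  anc-defined : ∀ k {u v} → anc par k u ≡ just v → ∀ i → i ℕ.≤ k → ∃ λ x → anc par i u ≡ just x
  anc-defined k {u} h i i≤k with anc par i u in eq
  ... | just x  = x , refl
  ... | nothing with () ← trans (sym h) (trans (cong (λ l → anc par l u) (sym (ℕP.m∸n+n≡m i≤k)))
                          (trans (anc-+ i (k ℕ.∸ i) u) (cong (_>>= anc par (k ℕ.∸ i)) eq)))

  -- A path of `n` or more edges has more than `n` vertices, so by the pigeonhole principle it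
  -- revisits one and closes a cycle. Hence fuel `n` suffices for the search in `inS`.
  anc-bounded : Acyclic par → ∀ {k u v} → anc par k u ≡ just v → k ℕ.< n
  anc-bounded acyclic {k} {u} h = ℕP.≰⇒> λ n≤k →
    let path : ∀ (i : Fin (suc n)) → ∃ λ x → anc par (toℕ i) u ≡ just x
        path i = anc-defined k h (toℕ i) (ℕP.≤-trans (ℕP.≤-pred (FinP.toℕ<n i)) n≤k)
        i , j , i<j , eq = FinP.pigeonhole (ℕP.n<1+n n) (proj₁ ∘ path)
    in acyclic _ (anc-< i<j (proj₂ (path i)) (trans (proj₂ (path j)) (cong just (sym eq))))

  search-sound : ∀ {v u} k → search par v u k ≡ true → ∃ λ i → anc par i u ≡ just v
  search-sound {v} {u} zero h = 0 , cong just (⌊⌋-sound (u FinP.≟ v) h)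
  search-sound {v} {u} (suc k) h with anc par k u >>= par in eq
  ... | nothing = search-sound k h
  ... | just x with x FinP.≟ v
  ...   | yes refl = suc k , eq
  ...   | no  _    = search-sound k h

  search-complete : ∀ {v u i} → anc par i u ≡ just v → ∀ k → i ℕ.≤ k → search par v u k ≡ true
  search-complete {v} {u} {zero} refl zero _ = ⌊⌋-complete (u FinP.≟ v) refl
  search-complete {v} {u} {i} h (suc k) i≤1+k with ℕP.m≤n⇒m<n∨m≡n i≤1+k
  ... | inj₁ i<1+k rewrite search-complete h k (ℕP.≤-pred i<1+k) = BoolP.∨-zeroʳ _
  ... | inj₂ refl rewrite h | ⌊⌋-complete (v FinP.≟ v) refl = refl

  inS-sound : ∀ {v u} → inS par v u ≡ true → ∃ λ i → anc par i u ≡ just v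
  inS-sound = search-sound n

  inS-complete : Acyclic par → ∀ {v u} i → anc par i u ≡ just v → inS par v u ≡ true
  inS-complete acyclic i h = search-complete {i = i} h n (ℕP.<⇒≤ (anc-bounded acyclic {i} h))

  module _ (C : Fin n → ℕ) where

    front-sound : ∀ {t j} → InFront par C t j → t ℕ.≤ C j × Ready par C j t
    front-sound {t} {j} h with par j
    ... | nothing = ⌊⌋-sound (t ℕ.≤? C j) (∧-elimˡ h) , λ _ ()
    ... | just j′ = ⌊⌋-sound (t ℕ.≤? C j) (∧-elimˡ h) ,
                    λ { _ refl → ⌊⌋-sound (C j′ ℕ.<? t) (∧-elimʳ h) }

    front-complete : ∀ {t j} → t ℕ.≤ C j → Ready par C j t → InFront par C t j
    front-complete {t} {j} t≤C ready with par j
    ... | nothing = ∧-intro (⌊⌋-complete (t ℕ.≤? C j) t≤C) refl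
    ... | just j′ = ∧-intro (⌊⌋-complete (t ℕ.≤? C j) t≤C) (⌊⌋-complete (C j′ ℕ.<? t) (ready j′ refl))

    -- Climb from `j` through unfinished ancestors until the parent is missing or completed before
    -- `t`. The invariant `n ℕ.≤ fuel ℕ.+ i` bounds the climb, since paths have fewer than `n`
    -- edges.
    front-ancestor : Acyclic par → ∀ {t j} → t ℕ.≤ C j →
                     ∃ λ a → InFront par C t a × inS par a j ≡ true
    front-ancestor acyclic {t} {j} t≤C = climb n 0 j refl (ℕP.≤-reflexive (sym (ℕP.+-identityʳ n))) t≤C
      where
      climb : ∀ fuel i a → anc par i j ≡ just a → n ℕ.≤ fuel ℕ.+ i → t ℕ.≤ C a →
              ∃ λ a → InFront par C t a × inS par a j ≡ true
      climb zero i a h n≤i _ = contradiction (anc-bounded acyclic {i} h) (ℕP.≤⇒≯ n≤i)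
      climb (suc fuel) i a h n≤ t≤Ca with par a in eq
      ... | nothing = a , front-complete t≤Ca (λ j′ e → case trans (sym eq) e of λ ()) , inS-complete acyclic i h
      ... | just b with C b ℕ.<? t
      ...   | yes Cb<t = a , front-complete t≤Ca (λ j′ e → subst (λ x → C x ℕ.< t) (just-injective (trans (sym eq) e)) Cb<t)
                         , inS-complete acyclic i h
      ...   | no  Cb≮t = climb fuel (suc i) b (trans (cong (_>>= par) h) eq)
                           (ℕP.≤-trans n≤ (ℕP.≤-reflexive (sym (ℕP.+-suc fuel i)))) (ℕP.≮⇒≥ Cb≮t)

  module _ {C : Fin n → ℕ} (ready : ∀ j → Ready par C j (C j)) where

    C-mono : ∀ i {u v} → anc par i u ≡ just v → C v ℕ.≤ C u
    C-mono zero refl = ℕP.≤-refl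
    C-mono (suc i) {u} h with anc par i u in eq
    ... | just x = ℕP.≤-trans (ℕP.<⇒≤ (ready x _ h)) (C-mono i eq)

    ProperPred⇒< : ∀ {u v} → ProperPred par v u → C v ℕ.< C u
    ProperPred⇒< {u} (i , h) with anc par i u in eq
    ... | just x = ℕP.<-≤-trans (ready x _ h) (C-mono i eq)

    inS⇒≤ : ∀ {u v} → inS par v u ≡ true → C v ℕ.≤ C u
    inS⇒≤ h with i , h′ ← inS-sound h = C-mono i h′

    ProperPred⇒<front : ∀ {t u v} → InFront par C t u → ProperPred par v u → C v ℕ.< t
    ProperPred⇒<front f (i , h) with x , eq ← anc-defined (suc i) h 1 (ℕ.s≤s ℕ.z≤n) =
      ℕP.≤-<-trans (C-mono i (anc-∸ {1} {suc i} (ℕ.s≤s ℕ.z≤n) eq h)) (proj₂ (front-sound C f) x eq)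

    front-incomparable : ∀ {t u v} → InFront par C t u → InFront par C t v → ¬ ProperPred par v u
    front-incomparable fu fv v<u = contradiction (ProperPred⇒<front fu v<u) (ℕP.≤⇒≯ (proj₁ (front-sound C fv)))

    -- In an out-forest the ancestors of `k` form a chain, while front jobs are pairwise
    -- incomparable.
    front-disjoint : ∀ {t u v k} → InFront par C t u → InFront par C t v →
                     inS par u k ≡ true → inS par v k ≡ true → u ≡ v
    front-disjoint fu fv hu hv
      with i , hu′ ← inS-sound hu | j , hv′ ← inS-sound hv
      with anc-comparable {i} {j} hu′ hv′
    ... | inj₁ u≡v        = u≡v
    ... | inj₂ (inj₁ v<u) = contradiction v<u (front-incomparable fu fv)
    ... | inj₂ (inj₂ u<v) = contradiction u<v (front-incomparable fv fu)

    -- Both jobs lie on the chain of ancestors of `k`, along which completion times are strictly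
    -- monotone.
    completed-disjoint : ∀ {u v k} → C u ≡ C v → inS par u k ≡ true → inS par v k ≡ true → u ≡ v
    completed-disjoint eq hu hv
      with i , hu′ ← inS-sound hu | j , hv′ ← inS-sound hv
      with anc-comparable {i} {j} hu′ hv′
    ... | inj₁ u≡v        = u≡v
    ... | inj₂ (inj₁ v<u) = contradiction (ProperPred⇒< v<u) (ℕP.<-irrefl (sym eq))
    ... | inj₂ (inj₂ u<v) = contradiction (ProperPred⇒< u<v) (ℕP.<-irrefl eq)

    front-width : ∀ {ω} → IsWidth par ω → ∀ t → countFin (front par C t) ℕ.≤ ω
    front-width (_ , maximal) t = ℕP.≤-trans (ℕP.≤-reflexive (count-filter (front par C t)))
      (maximal (frontList) ((UniqueP.filter⁺ isFront? (UniqueP.allFin⁺ n)) ,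
        λ u v u∈ v∈ → front-incomparable (proj₂ (∈-filter⁻ isFront? {xs = allFin n} v∈))
                                         (proj₂ (∈-filter⁻ isFront? {xs = allFin n} u∈))))
      where
      isFront? = λ j → front par C t j BoolP.≟ true
      frontList = filter isFront? (allFin n)
      count-map : ∀ {k m} (b : Fin m → Bool) (g : Fin k → Fin m) →
                  countFin (b ∘ g) ≡ length (filter (λ j → b j BoolP.≟ true) (List.tabulate g))
      count-map {zero} b g = refl
      count-map {suc k} b g with b (g Fin.zero)
      ... | true  = cong suc (count-map b (g ∘ Fin.suc))
      ... | false = count-map b (g ∘ Fin.suc)
      count-filter : ∀ {m} (b : Fin m → Bool) → countFin b ≡ length (filter (λ j → b j BoolP.≟ true) (allFin m))
      count-filter b = count-map b (λ i → i)

-- Sums over time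

count≤sum : ∀ {c T} → c ℕ.≤ T → (f : ℕ → ℚ) → (∀ s → 0ℚ ≤ f s) → (∀ s → s ℕ.< c → 1ℚ ≤ f s) →
            ℕ→ℚ c ≤ sumFin {T} (λ s → f (toℕ s))
count≤sum {T = T} ℕ.z≤n f 0≤f 1≤f = 0≤sum {n = T} (λ s → 0≤f (toℕ s))
count≤sum (ℕ.s≤s {c} {T} c≤T) f 0≤f 1≤f = ≤-trans (≤-reflexive (ℕ→ℚ-suc c))
  (+-mono-≤ (1≤f 0 (ℕ.s≤s ℕ.z≤n)) (count≤sum c≤T (f ∘ suc) (0≤f ∘ suc) (λ s s<c → 1≤f (suc s) (ℕ.s≤s s<c))))

-- Only slots before `c` contribute, so the sum stops growing there and the bounds on shorter
-- prefixes extend to every `T`. Index `s` stands for slot `suc s`.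
sum-truncated : ∀ (y : ℕ → ℚ) c P → 0ℚ ≤ P →
                (∀ T → T ℕ.< c → sumFin {T} (λ s → y (toℕ s)) ≤ P) →
                ∀ T → sumFin {T} (λ s → y (toℕ s) * ind ⌊ suc (toℕ s) ℕ.<? c ⌋) ≤ P
sum-truncated y c P 0≤P bound zero = 0≤P
sum-truncated y c P 0≤P bound (suc T) = case suc T ℕ.<? c of λ
  { (yes 1+T<c) → ≤-trans (≤-reflexive (sum-cong λ s →
      trans (cong (λ b → y (toℕ s) * ind b)
              (⌊⌋-complete (suc (toℕ s) ℕ.<? c) (ℕP.≤-<-trans (FinP.toℕ<n s) 1+T<c)))
            (*-identityʳ (y (toℕ s))))) (bound (suc T) 1+T<c)
  ; (no 1+T≮c) → begin
      sumFin {suc T} (λ s → y′ (toℕ s))     ≡⟨ sum-last y′ T ⟩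
      sumFin {T} (λ s → y′ (toℕ s)) + y′ T  ≡⟨ cong (sumFin {T} (λ s → y′ (toℕ s)) +_)
                                                 (trans (cong (λ b → y T * ind b) (⌊⌋-refute (suc T ℕ.<? c) 1+T≮c)) (*-zeroʳ (y T))) ⟩
      sumFin {T} (λ s → y′ (toℕ s)) + 0ℚ    ≡⟨ +-identityʳ (sumFin {T} (λ s → y′ (toℕ s))) ⟩
      sumFin {T} (λ s → y′ (toℕ s))         ≤⟨ sum-truncated y c P 0≤P bound T ⟩
      P                                     ∎ }
  where
  open ≤-Reasoning
  y′ : ℕ → ℚ
  y′ s = y s * ind ⌊ suc s ℕ.<? c ⌋

-- Schedules

module _ {n : ℕ} (par : Forest n) where

  cum-sum : ∀ R T j → cum par R T j ≡ sumFin {T} (λ s → R (suc (toℕ s)) j)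
  cum-sum R zero    j = refl
  cum-sum R (suc T) j = trans (cong (_+ R (suc T) j) (cum-sum R T j)) (sym (sum-last (λ s → R (suc s) j) T))

  wS-ind : ∀ w v → wS par w v ≡ sumFin (λ u → ind (inS par v u) * w u)
  wS-ind w v = sum-cong λ u → if-ind (inS par v u) (w u)
    where
    if-ind : ∀ b y → (if b then y else 0ℚ) ≡ ind b * y
    if-ind true  y = sym (*-identityˡ y)
    if-ind false y = sym (*-zeroˡ y)

  0≤wS : ∀ {w} → (∀ j → 0ℚ ≤ w j) → ∀ v → 0ℚ ≤ wS par w v
  0≤wS {w} 0≤w v = ≤-trans (0≤sum (λ u → 0≤* (0≤ind (inS par v u)) (0≤w u))) (≤-reflexive (sym (wS-ind w v)))

  Ready? : ∀ C j t → Dec (Ready par C j t)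
  Ready? C j t with par j
  ... | nothing = yes λ _ ()
  ... | just j′ with C j′ ℕ.<? t
  ...   | yes lt = yes λ { _ refl → lt }
  ...   | no ¬lt = no λ ready → ¬lt (ready j′ refl)

  Ready-mono : ∀ {C j s t} → s ℕ.≤ t → Ready par C j s → Ready par C j t
  Ready-mono s≤t ready j′ eq = ℕP.<-≤-trans (ready j′ eq) s≤t

  -- Being in the front in slot `t` gives `t` ≤ `C j` and the negated test gives `C j` ≤ `t`, so
  -- only the slot `C j` can count.
  final-slot : ∀ C T j → sumFin {T} (λ s → ind (front par C (suc (toℕ s)) j) * ind (not ⌊ suc (toℕ s) ℕ.<? C j ⌋)) ≤ 1ℚ
  final-slot C T j = ≤-trans (≤-reflexive (sum-cong {n = T} (λ s → sym (ind-∧ (front par C (suc (toℕ s)) j) (not ⌊ suc (toℕ s) ℕ.<? C j ⌋)))))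
    (sum-exclusive final λ s s′ h h′ → FinP.toℕ-injective (ℕP.suc-injective (trans (is-C s h) (sym (is-C s′ h′)))))
    where
    final : Fin T → Bool
    final s = front par C (suc (toℕ s)) j ∧ not ⌊ suc (toℕ s) ℕ.<? C j ⌋
    is-C : ∀ s → final s ≡ true → suc (toℕ s) ≡ C j
    is-C s h = ℕP.≤-antisym (proj₁ (front-sound par C (∧-elimˡ h))) (not-< (∧-elimʳ {front par C (suc (toℕ s)) j} h))

  -- The half of `IsCompletion` that unfinished runs satisfy as well; stated separately, it lets the
  -- bounds below serve both the simulation and the complete run.
  Minimal : (Fin n → ℚ) → Rates par → (Fin n → ℕ) → Set
  Minimal p R C = ∀ j t → 1 ℕ.≤ t → t ℕ.< C j → ¬ (Ready par C j t × p j ≤ cum par R t j)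

  module FrontRun (C : Fin n → ℕ) (R : Rates par) (idle : ∀ {t j} → front par C t j ≡ false → R t j ≡ 0ℚ)
                  (p : Fin n → ℚ) (0≤p : ∀ j → 0ℚ ≤ p j) (minimal : Minimal p R C) where

    -- A job that is ready but not complete has received less than `p j`, by minimality. A job that
    -- is not ready has never been in the front and has received nothing.
    cum≤p : ∀ j t → t ℕ.< C j → cum par R t j ≤ p j
    cum≤p j zero    _ = 0≤p j
    cum≤p j (suc t) t<C = case Ready? C j (suc t) of λ
      { (yes ready) → <⇒≤ (≰⇒> λ p≤cum → minimal j (suc t) (ℕ.s≤s ℕ.z≤n) t<C (ready , p≤cum))
      ; (no ¬ready) → ≤-trans (≤-reflexive (trans (cum-sum R (suc t) j)
          (trans (sum-cong (λ s → idle (not-front s ¬ready))) (sum-0 (suc t))))) (0≤p j) }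
      where
      not-front : ∀ s → ¬ Ready par C j (suc t) → front par C (suc (toℕ {suc t} s)) j ≡ false
      not-front s ¬ready = case true-or-false (front par C (suc (toℕ s)) j) of λ
        { (inj₁ fr) → contradiction (Ready-mono (FinP.toℕ<n s) (proj₂ (front-sound par C fr))) ¬ready
        ; (inj₂ eq) → eq }

    -- The slot `C j` is left out because the rate in it may overshoot `p j`.
    processed≤p : ∀ T j → sumFin {T} (λ s → R (suc (toℕ s)) j * ind ⌊ suc (toℕ s) ℕ.<? C j ⌋) ≤ p j
    processed≤p T j = sum-truncated (λ s → R (suc s) j) (C j) (p j) (0≤p j)
      (λ T T<C → ≤-trans (≤-reflexive (sym (cum-sum R T j))) (cum≤p j T T<C)) T

  module Schedule {R : Rates par} {C : Fin n → ℕ} (feasible : Feasible par R C)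
                  {p : Fin n → ℚ} (0≤p : ∀ j → 0ℚ ≤ p j) (completion : IsCompletion par p R C) where

    ready : ∀ j → Ready par C j (C j)
    ready j = proj₁ (proj₂ (proj₁ (completion j)))

    0≤cum : ∀ t j → 0ℚ ≤ cum par R t j
    0≤cum zero    j = ≤-refl
    0≤cum (suc t) j = 0≤+ (0≤cum t j) (proj₁ (feasible (suc t) (ℕ.s≤s ℕ.z≤n)) j)

    cum-mono : ∀ {s t} j → s ℕ.≤ t → cum par R s j ≤ cum par R t j
    cum-mono {s} {t} j s≤t = ≤-trans (mono (t ℕ.∸ s)) (≤-reflexive (cong (λ t → cum par R t j) (ℕP.m∸n+n≡m s≤t)))
      where
      mono : ∀ k → cum par R s j ≤ cum par R (k ℕ.+ s) j
      mono zero    = ≤-refl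
      mono (suc k) = ≤-trans (mono k) (≤-+ʳ (proj₁ (feasible (suc (k ℕ.+ s)) (ℕ.s≤s ℕ.z≤n)) j))

    sum-cum : ∀ T → sumFin (cum par R T) ≤ ℕ→ℚ T
    sum-cum T = begin
      sumFin (λ j → cum par R T j)                               ≡⟨ sum-cong (cum-sum R T) ⟩
      sumFin (λ j → sumFin {T} (λ s → R (suc (toℕ s)) j))        ≡⟨ sum-swap {n = T} (λ j s → R (suc (toℕ s)) j) ⟩
      sumFin {T} (λ s → sumFin (R (suc (toℕ s))))                ≤⟨ sum-mono {n = T} (λ s → proj₁ (proj₂ (feasible (suc (toℕ s)) (ℕ.s≤s ℕ.z≤n)))) ⟩
      sumFin {T} (λ _ → 1ℚ)                                      ≡⟨ sum-const1 T ⟩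
      ℕ→ℚ T                                                      ∎
      where open ≤-Reasoning

    late : Fin n → Fin n → ℚ
    late a k = ind ⌊ C a ℕ.≤? C k ⌋

    -- Every job completed by time `C k` has received its full requirement by then, and the machine
    -- has unit speed.
    late-work : ∀ k → sumFin (λ a → late a k * p a) ≤ ℕ→ℚ (C k)
    late-work k = ≤-trans (sum-mono λ a → ind-* ⌊ C a ℕ.≤? C k ⌋
      (λ h → ≤-trans (proj₂ (proj₂ (proj₁ (completion a)))) (cum-mono a (⌊⌋-sound (C a ℕ.≤? C k) h)))
      (0≤cum (C k) a)) (sum-cum (C k))

    -- The sum is the depth of `k` in the forest. The completion times of `k` and its ancestors are
    -- distinct slots among 1, ..., `C k`.
    depth≤C : ∀ k → sumFin (λ b → ind (inS par b k)) ≤ ℕ→ℚ (C k)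
    depth≤C k = begin
      sumFin (λ b → ind (inS par b k))                            ≤⟨ sum-mono at-slot ⟩
      sumFin (λ b → sumFin {C k} (λ s → ind (ends b s)))          ≡⟨ sum-swap (λ b s → ind (ends b s)) ⟩
      sumFin {C k} (λ s → sumFin (λ b → ind (ends b s)))          ≤⟨ sum-mono (λ s → sum-exclusive (λ b → ends b s) (exclusive s)) ⟩
      sumFin {C k} (λ _ → 1ℚ)                                     ≡⟨ sum-const1 (C k) ⟩
      ℕ→ℚ (C k)                                                   ∎
      where
      open ≤-Reasoning
      ends : Fin n → Fin (C k) → Bool
      ends b s = inS par b k ∧ ⌊ C b ℕ.≟ suc (toℕ s) ⌋
      exclusive : ∀ s b b′ → ends b s ≡ true → ends b′ s ≡ true → b ≡ b′
      exclusive s b b′ h h′ = completed-disjoint par {C} ready {k = k}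
        (trans (⌊⌋-sound (C b ℕ.≟ suc (toℕ s)) (∧-elimʳ {inS par b k} h))
               (sym (⌊⌋-sound (C b′ ℕ.≟ suc (toℕ s)) (∧-elimʳ {inS par b′ k} h′))))
        (∧-elimˡ h) (∧-elimˡ h′)
      slot : ∀ b → C b ℕ.≤ C k → ∃ λ (s : Fin (C k)) → C b ≡ suc (toℕ s)
      slot b Cb≤Ck with C b | proj₁ (proj₁ (completion b))
      ... | suc c | _ = Fin.fromℕ< Cb≤Ck , cong suc (sym (FinP.toℕ-fromℕ< Cb≤Ck))
      at-slot : ∀ b → ind (inS par b k) ≤ sumFin {C k} (λ s → ind (ends b s))
      at-slot b = case true-or-false (inS par b k) of λ
        { (inj₂ eq) → ≤-trans (≤-reflexive (cong ind eq)) (0≤sum (λ s → 0≤ind (ends b s)))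
        ; (inj₁ eq) → let s , Cb≡ = slot b (inS⇒≤ par {C} ready eq) in
            ≤-trans (≤-reflexive (cong ind (trans eq (sym (∧-intro eq (⌊⌋-complete (C b ℕ.≟ suc (toℕ s)) Cb≡))))))
                    (term≤sum {f = λ s → ind (ends b s)} (λ s → 0≤ind (ends b s)) s) }

    module _ {w : Fin n → ℚ} (0≤w : ∀ j → 0ℚ ≤ w j) where

      E : Fin n → ℚ
      E a = sumFin (λ k → late a k * w k)

      0≤E : ∀ a → 0ℚ ≤ E a
      0≤E a = 0≤sum (λ k → 0≤* (0≤ind ⌊ C a ℕ.≤? C k ⌋) (0≤w k))

      -- After the sums are exchanged, `w k` is multiplied by the total requirement of the jobs
      -- completed by `C k`.
      work≤cost : sumFin (λ a → p a * E a) ≤ cost par w C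
      work≤cost = begin
        sumFin (λ a → p a * E a)
          ≡⟨ sum-cong (λ a → trans (sym (sum-*ˡ (p a) (λ k → late a k * w k)))
               (sum-cong (λ k → solve 3 (λ p l w → p :* (l :* w) := w :* (l :* p)) refl (p a) (late a k) (w k)))) ⟩
        sumFin (λ a → sumFin (λ k → w k * (late a k * p a)))
          ≡⟨ sum-swap (λ a k → w k * (late a k * p a)) ⟩
        sumFin (λ k → sumFin (λ a → w k * (late a k * p a)))
          ≡⟨ sum-cong (λ k → sum-*ˡ (w k) (λ a → late a k * p a)) ⟩
        sumFin (λ k → w k * sumFin (λ a → late a k * p a))
          ≤⟨ sum-mono (λ k → *-monoʳ-≤ (0≤w k) (late-work k)) ⟩
        cost par w C ∎
        where
        open ≤-Reasoning
        open +-*-Solver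

      -- After the sums are exchanged, `w k` is multiplied by the depth of `k`.
      sum-wS≤cost : sumFin (wS par w) ≤ cost par w C
      sum-wS≤cost = begin
        sumFin (wS par w)
          ≡⟨ sum-cong (wS-ind w) ⟩
        sumFin (λ b → sumFin (λ k → ind (inS par b k) * w k))
          ≡⟨ sum-swap (λ b k → ind (inS par b k) * w k) ⟩
        sumFin (λ k → sumFin (λ b → ind (inS par b k) * w k))
          ≡⟨ sum-cong (λ k → trans (sum-*ʳ (w k) (λ b → ind (inS par b k))) (*-comm (sumFin (λ b → ind (inS par b k))) (w k))) ⟩
        sumFin (λ k → w k * sumFin (λ b → ind (inS par b k)))
          ≤⟨ sum-mono (λ k → *-monoʳ-≤ (0≤w k) (depth≤C k)) ⟩
        cost par w C ∎
        where open ≤-Reasoning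

-- The competitive ratio of a complete run

module Competitive
  {n : ℕ} (par : Forest n) (acyclic : Acyclic par)
  {p w : Fin n → ℚ} (0≤p : ∀ j → 0ℚ ≤ p j) (0≤w : ∀ j → 0ℚ ≤ w j)
  {ε : ℚ} (0<ε : 0ℚ < ε) (π : Predictions par) (valid : ValidPredictions par π)
  {ω : ℕ} (width : IsWidth par ω)
  (C : Fin n → ℕ) (ready : ∀ j → Ready par C j (C j))
  (R : Rates par)
  (0≤R : ∀ t j → 0ℚ ≤ R t j) (ΣR≤1 : ∀ t → sumFin (R t) ≤ 1ℚ)
  (idle : ∀ {t j} → front par C t j ≡ false → R t j ≡ 0ℚ)
  (R-inverse : ∀ {t j} → front par C t j ≡ true →
     R t j * (H (countFin (front par C t)) * ℕ→ℚ (position par π C t j)) ≡ 1ℚ)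
  (R-antimono : ∀ {t i j} → front par C t i ≡ true → front par C t j ≡ true → π t i ℕ.≤ π t j → R t j ≤ R t i)
  (minimal : Minimal par p R C)
  {L : ℕ} (L-bound : ∀ t j → 1 ℕ.≤ t → InFront par C t j → Lcount par w ε π C t j ℕ.≤ L)
  {R′ : Rates par} {C′ : Fin n → ℕ}
  (feasible : Feasible par R′ C′) (completion : IsCompletion par p R′ C′)
  where

  open Schedule par feasible 0≤p completion using (late; work≤cost; sum-wS≤cost)
    renaming (ready to ready′; E to E′; 0≤E to 0≤E′)
  open ≤-Reasoning

  x : Fin n → ℚ
  x = wS par w

  0≤x : ∀ j → 0ℚ ≤ x j
  0≤x = 0≤wS par 0≤w

  E : Fin n → ℚ
  E = E′ 0≤w

  -- The weight inside S(b) that the other schedule completes no earlier than `a`.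
  D : Fin n → Fin n → ℚ
  D a b = sumFin (λ k → ind (inS par b k) * (late a k * w k))

  0≤late : ∀ a k → 0ℚ ≤ late a k * w k
  0≤late a k = 0≤* (0≤ind ⌊ C′ a ℕ.≤? C′ k ⌋) (0≤w k)

  0≤D : ∀ a b → 0ℚ ≤ D a b
  0≤D a b = 0≤sum (λ k → 0≤* (0≤ind (inS par b k)) (0≤late a k))

  -- In the other schedule no job of S(b) completes before b.
  x≤D : ∀ {a b} → C′ a ℕ.≤ C′ b → x b ≤ D a b
  x≤D {a} {b} a≤b = ≤-trans (≤-reflexive (wS-ind par w b)) (sum-mono λ k → ind-*-mono (inS par b k) λ b∈ →
    ≤-reflexive (sym (trans (cong (λ y → ind y * w k)
      (⌊⌋-complete (C′ a ℕ.≤? C′ k) (ℕP.≤-trans a≤b (inS⇒≤ par {C′} ready′ b∈)))) (*-identityˡ (w k)))))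

  -- The sets S(b) of the front jobs are disjoint, so no weight is counted twice.
  ΣD≤E : ∀ t a → sumFin (λ b → ind (front par C t b) * D a b) ≤ E a
  ΣD≤E t a = begin
    sumFin (λ b → ind (F b) * D a b)
      ≡⟨ sum-cong (λ b → trans (sym (sum-*ˡ (ind (F b)) (λ k → ind (inS par b k) * y k)))
           (sum-cong (λ k → trans (sym (*-assoc (ind (F b)) (ind (inS par b k)) (y k)))
             (cong (_* y k) (sym (ind-∧ (F b) (inS par b k))))))) ⟩
    sumFin (λ b → sumFin (λ k → ind (F b ∧ inS par b k) * y k))
      ≡⟨ sum-swap (λ b k → ind (F b ∧ inS par b k) * y k) ⟩
    sumFin (λ k → sumFin (λ b → ind (F b ∧ inS par b k) * y k))
      ≤⟨ sum-mono (λ k → begin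
           sumFin (λ b → ind (F b ∧ inS par b k) * y k)  ≡⟨ sum-*ʳ (y k) (λ b → ind (F b ∧ inS par b k)) ⟩
           sumFin (λ b → ind (F b ∧ inS par b k)) * y k  ≤⟨ *-monoˡ-≤ (0≤late a k) (sum-exclusive (λ b → F b ∧ inS par b k) (exclusive k)) ⟩
           1ℚ * y k                                      ≡⟨ *-identityˡ (y k) ⟩
           y k                                           ∎) ⟩
    E a ∎
    where
    F : Fin n → Bool
    F = front par C t
    y : Fin n → ℚ
    y k = late a k * w k
    exclusive : ∀ k b b′ → F b ∧ inS par b k ≡ true → F b′ ∧ inS par b′ k ≡ true → b ≡ b′
    exclusive k b b′ h h′ = front-disjoint par {C} ready {t} {k = k} (∧-elimˡ h) (∧-elimˡ h′)
      (∧-elimʳ {F b} h) (∧-elimʳ {F b′} h′)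

  busy : ℕ → Fin n → Bool
  busy t a = ⌊ t ℕ.<? C a ⌋

  -- What the pair {a , b} may charge to the work on a, unless a is in its last
  -- slot, plus what it may charge to the last slot of b.
  G : ℕ → Fin n → Fin n → ℚ
  G t a b = R t a * (ind (busy t a) * D a b + ind (not (busy t b)) * x b)

  0≤G₁ : ∀ t a b → 0ℚ ≤ ind (busy t a) * D a b
  0≤G₁ t a b = 0≤* (0≤ind (busy t a)) (0≤D a b)

  0≤G₂ : ∀ t b → 0ℚ ≤ ind (not (busy t b)) * x b
  0≤G₂ t b = 0≤* (0≤ind (not (busy t b))) (0≤x b)

  0≤G : ∀ t a b → 0ℚ ≤ G t a b
  0≤G t a b = 0≤* (0≤R t a) (0≤+ (0≤G₁ t a b) (0≤G₂ t b))

  charge-last : ∀ t a b → busy t b ≡ false → R t a * x b ≤ G t a b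
  charge-last t a b last = *-monoʳ-≤ (0≤R t a) (≤-trans
    (≤-reflexive (sym (trans (cong (λ y → ind (not y) * x b) last) (*-identityˡ (x b))))) (≤-+ˡ (0≤G₁ t a b)))

  charge-busy : ∀ t a b → busy t a ≡ true → C′ a ℕ.≤ C′ b → R t a * x b ≤ G t a b
  charge-busy t a b isBusy a≤b = *-monoʳ-≤ (0≤R t a) (≤-trans (x≤D a≤b) (≤-trans
    (≤-reflexive (sym (trans (cong (λ y → ind y * D a b) isBusy) (*-identityˡ (D a b))))) (≤-+ʳ (0≤G₂ t b))))

  charge : ∀ t a b → R t a * x b ≤ G t a b ⊎ R t b * x a ≤ G t b a
  charge t a b = case true-or-false (busy t a) of λ
    { (inj₂ a-last) → inj₂ (charge-last t b a a-last)
    ; (inj₁ a-busy) → case true-or-false (busy t b) of λ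
      { (inj₂ b-last) → inj₁ (charge-last t a b b-last)
      ; (inj₁ b-busy) → case ℕP.≤-total (C′ a) (C′ b) of λ
        { (inj₁ a≤b) → inj₁ (charge-busy t a b a-busy a≤b)
        ; (inj₂ b≤a) → inj₂ (charge-busy t b a b-busy b≤a) } } }

  M K : ℚ
  M = (1ℚ + ε) ⊔ ℕ→ℚ L
  K = M + M

  0≤K : 0ℚ ≤ K
  0≤K = 0≤+ 0≤M 0≤M
    where
    0≤M : 0ℚ ≤ M
    0≤M = ≤-trans (0≤+ 0≤1 (<⇒≤ 0<ε)) (p≤p⊔q (1ℚ + ε) (ℕ→ℚ L))

  work final : ℕ → ℚ
  work t  = sumFin (λ a → R t a * ind (busy t a) * E a)
  final t = sumFin (λ b → ind (front par C t b) * ind (not (busy t b)) * x b)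

  0≤final : ∀ t → 0ℚ ≤ final t
  0≤final t = 0≤sum (λ b → 0≤* (0≤* (0≤ind (front par C t b)) (0≤ind (not (busy t b)))) (0≤x b))

  -- For fixed `a` the first parts of `G` add up to at most `E a` times the rate of `a`. The second
  -- parts depend on `a` only through its rate, and the rates sum to at most 1.
  ΣG≤ : ∀ t → sumFin (λ a → sumFin (λ b → ind (front par C t a) * ind (front par C t b) * G t a b)) ≤ work t + final t
  ΣG≤ t = begin
    sumFin (λ a → sumFin (λ b → φ a * φ b * G t a b))
      ≤⟨ sum-mono (λ a → begin
           sumFin (λ b → φ a * φ b * G t a b)
             ≤⟨ sum-mono (λ b → expand a b) ⟩
           sumFin (λ b → R t a * ind (busy t a) * (φ b * D a b) + R t a * (φ b * ind (not (busy t b)) * x b))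
             ≡⟨ trans (sum-+ (λ b → R t a * ind (busy t a) * (φ b * D a b)) (λ b → R t a * (φ b * ind (not (busy t b)) * x b)))
                  (cong₂ _+_ (sum-*ˡ (R t a * ind (busy t a)) (λ b → φ b * D a b))
                             (sum-*ˡ (R t a) (λ b → φ b * ind (not (busy t b)) * x b))) ⟩
           R t a * ind (busy t a) * sumFin (λ b → φ b * D a b) + R t a * final t
             ≤⟨ +-monoˡ-≤ (R t a * final t) (*-monoʳ-≤ (0≤* (0≤R t a) (0≤ind (busy t a))) (ΣD≤E t a)) ⟩
           R t a * ind (busy t a) * E a + R t a * final t ∎) ⟩
    sumFin (λ a → R t a * ind (busy t a) * E a + R t a * final t)
      ≡⟨ trans (sum-+ (λ a → R t a * ind (busy t a) * E a) (λ a → R t a * final t))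
           (cong (work t +_) (sum-*ʳ (final t) (R t))) ⟩
    work t + sumFin (R t) * final t
      ≤⟨ +-monoʳ-≤ (work t) (≤-trans (*-monoˡ-≤ (0≤final t) (ΣR≤1 t)) (≤-reflexive (*-identityˡ (final t)))) ⟩
    work t + final t ∎
    where
    φ : Fin n → ℚ
    φ a = ind (front par C t a)
    expand : ∀ a b → φ a * φ b * G t a b ≤ R t a * ind (busy t a) * (φ b * D a b) + R t a * (φ b * ind (not (busy t b)) * x b)
    expand a b = begin
      φ a * φ b * G t a b
        ≡⟨ *-assoc (φ a) (φ b) (G t a b) ⟩
      φ a * (φ b * G t a b)
        ≤⟨ *-monoˡ-≤ (0≤* (0≤ind (front par C t b)) (0≤G t a b)) (ind≤1 (front par C t a)) ⟩
      1ℚ * (φ b * G t a b)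
        ≡⟨ solve 6 (λ f r b d l y → con 1ℚ :* (f :* (r :* (b :* d :+ l :* y))) := r :* b :* (f :* d) :+ r :* (f :* l :* y)) refl
             (φ b) (R t a) (ind (busy t a)) (D a b) (ind (not (busy t b))) (x b) ⟩
      R t a * ind (busy t a) * (φ b * D a b) + R t a * (φ b * ind (not (busy t b)) * x b) ∎
      where open +-*-Solver

  slot-bound : ∀ t → 1 ℕ.≤ t → sumFin (λ b → ind (front par C t b) * x b) ≤ H ω * K * (work t + final t)
  slot-bound t 1≤t = begin
    sumFin (λ b → ind (front par C t b) * x b)
      ≤⟨ PairCharging.charge-all (front par C t) (π t) (valid t) (H size) (0≤H size) (R t) (0≤R t) R-inverse R-antimono
           x 0≤x ε 0<ε L (λ {j} → L-bound t j 1≤t) (G t) (0≤G t) (λ a b _ _ → charge t a b) ⟩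
    H size * K * ΣG
      ≤⟨ *-monoʳ-≤ (0≤* (0≤H size) 0≤K) (ΣG≤ t) ⟩
    H size * K * (work t + final t)
      ≤⟨ *-monoˡ-≤ (0≤+ (0≤sum (λ a → 0≤* (0≤* (0≤R t a) (0≤ind (busy t a))) (0≤E′ 0≤w a))) (0≤final t))
           (*-monoˡ-≤ 0≤K (H-mono (front-width par {C} ready width t))) ⟩
    H ω * K * (work t + final t) ∎
    where
    size = countFin (front par C t)
    ΣG = sumFin (λ a → sumFin (λ b → ind (front par C t a) * ind (front par C t b) * G t a b))

  -- In each of the slots 1, ..., `C j` some front job has `j` in its subtree, so `w j` is counted
  -- in `x` of that front job.
  cost≤front-weight : ∀ T → (∀ j → C j ℕ.≤ T) →
    cost par w C ≤ sumFin {T} (λ s → sumFin (λ a → ind (front par C (suc (toℕ s)) a) * x a))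
  cost≤front-weight T C≤T = begin
    sumFin (λ j → w j * ℕ→ℚ (C j))
      ≤⟨ sum-mono (λ j → *-monoʳ-≤ (0≤w j) (count≤sum (C≤T j) (cover j) (0≤cover j) (1≤cover j))) ⟩
    sumFin (λ j → w j * sumFin {T} (λ s → cover j (toℕ s)))
      ≡⟨ sum-cong (λ j → sym (sum-*ˡ {n = T} (w j) (λ s → cover j (toℕ s)))) ⟩
    sumFin (λ j → sumFin {T} (λ s → w j * cover j (toℕ s)))
      ≡⟨ sum-swap {n = T} (λ j s → w j * cover j (toℕ s)) ⟩
    sumFin {T} (λ s → sumFin (λ j → w j * cover j (toℕ s)))
      ≡⟨ sum-cong {n = T} (λ s → regroup (toℕ s)) ⟩
    sumFin {T} (λ s → sumFin (λ a → φ (toℕ s) a * x a)) ∎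
    where
    φ : ℕ → Fin n → ℚ
    φ s a = ind (front par C (suc s) a)
    cover : Fin n → ℕ → ℚ
    cover j s = sumFin (λ a → φ s a * ind (inS par a j))
    0≤terms : ∀ j s a → 0ℚ ≤ φ s a * ind (inS par a j)
    0≤terms j s a = 0≤* (0≤ind (front par C (suc s) a)) (0≤ind (inS par a j))
    0≤cover : ∀ j s → 0ℚ ≤ cover j s
    0≤cover j s = 0≤sum (0≤terms j s)
    1≤cover : ∀ j s → s ℕ.< C j → 1ℚ ≤ cover j s
    1≤cover j s s<C = let a , fa , a∈ = front-ancestor par C acyclic s<C in
      ≤-trans (≤-reflexive (sym (trans (cong₂ (λ y z → ind y * ind z) fa a∈) (*-identityˡ 1ℚ))))
        (term≤sum {f = λ a → φ s a * ind (inS par a j)} (0≤terms j s) a)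
    regroup : ∀ s → sumFin (λ j → w j * cover j s) ≡ sumFin (λ a → φ s a * x a)
    regroup s = trans (sum-cong λ j → trans (sym (sum-*ˡ (w j) (λ a → φ s a * ind (inS par a j))))
        (sum-cong λ a → solve 3 (λ w f i → w :* (f :* i) := f :* (i :* w)) refl (w j) (φ s a) (ind (inS par a j))))
      (trans (sum-swap (λ j a → φ s a * (ind (inS par a j) * w j)))
        (sum-cong λ a → trans (sum-*ˡ (φ s a) (λ j → ind (inS par a j) * w j)) (cong (φ s a *_) (sym (wS-ind par w a)))))
      where open +-*-Solver

  Σwork≤cost : ∀ T → sumFin {T} (λ s → work (suc (toℕ s))) ≤ cost par w C′
  Σwork≤cost T = begin
    sumFin {T} (λ s → sumFin (λ a → R (suc (toℕ s)) a * ind (busy (suc (toℕ s)) a) * E a))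
      ≡⟨ sum-swap {m = T} (λ s a → R (suc (toℕ s)) a * ind (busy (suc (toℕ s)) a) * E a) ⟩
    sumFin (λ a → sumFin {T} (λ s → R (suc (toℕ s)) a * ind (busy (suc (toℕ s)) a) * E a))
      ≡⟨ sum-cong (λ a → sum-*ʳ {n = T} (E a) (λ s → R (suc (toℕ s)) a * ind (busy (suc (toℕ s)) a))) ⟩
    sumFin (λ a → sumFin {T} (λ s → R (suc (toℕ s)) a * ind (busy (suc (toℕ s)) a)) * E a)
      ≤⟨ sum-mono (λ a → *-monoˡ-≤ (0≤E′ 0≤w a) (FrontRun.processed≤p par C R idle p 0≤p minimal T a)) ⟩
    sumFin (λ a → p a * E a)
      ≤⟨ work≤cost 0≤w ⟩
    cost par w C′ ∎

  Σfinal≤cost : ∀ T → sumFin {T} (λ s → final (suc (toℕ s))) ≤ cost par w C′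
  Σfinal≤cost T = begin
    sumFin {T} (λ s → sumFin (λ b → ψ s b * x b))
      ≡⟨ sum-swap {m = T} (λ s b → ψ s b * x b) ⟩
    sumFin (λ b → sumFin {T} (λ s → ψ s b * x b))
      ≡⟨ sum-cong (λ b → sum-*ʳ {n = T} (x b) (λ s → ψ s b)) ⟩
    sumFin (λ b → sumFin {T} (λ s → ψ s b) * x b)
      ≤⟨ sum-mono (λ b → ≤-trans (*-monoˡ-≤ (0≤x b) (final-slot par C T b)) (≤-reflexive (*-identityˡ (x b)))) ⟩
    sumFin x
      ≤⟨ sum-wS≤cost 0≤w ⟩
    cost par w C′ ∎
    where
    ψ : Fin T → Fin n → ℚ
    ψ s b = ind (front par C (suc (toℕ s)) b) * ind (not (busy (suc (toℕ s)) b))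

  competitive : ∀ T → (∀ j → C j ℕ.≤ T) → cost par w C ≤ ((ℕ→ℚ 4 * H ω) * M) * cost par w C′
  competitive T C≤T = begin
    cost par w C
      ≤⟨ cost≤front-weight T C≤T ⟩
    sumFin {T} (λ s → sumFin (λ a → ind (front par C (suc (toℕ s)) a) * x a))
      ≤⟨ sum-mono {n = T} (λ s → slot-bound (suc (toℕ s)) (ℕ.s≤s ℕ.z≤n)) ⟩
    sumFin {T} (λ s → H ω * K * (work (suc (toℕ s)) + final (suc (toℕ s))))
      ≡⟨ trans (sum-*ˡ {n = T} (H ω * K) (λ s → work (suc (toℕ s)) + final (suc (toℕ s))))
           (cong (H ω * K *_) (sum-+ {n = T} (λ s → work (suc (toℕ s))) (λ s → final (suc (toℕ s))))) ⟩
    H ω * K * (sumFin {T} (λ s → work (suc (toℕ s))) + sumFin {T} (λ s → final (suc (toℕ s))))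
      ≤⟨ *-monoʳ-≤ (0≤* (0≤H ω) 0≤K) (+-mono-≤ (Σwork≤cost T) (Σfinal≤cost T)) ⟩
    H ω * K * (cost par w C′ + cost par w C′)
      -- One factor 2 comes from `K`, the other from bounding the `work` and `final` totals
      -- separately by the cost of the other schedule.
      ≡⟨ solve 3 (λ h m c → h :* (m :+ m) :* (c :+ c) := con (ℕ→ℚ 4) :* h :* m :* c) refl (H ω) M (cost par w C′) ⟩
    ((ℕ→ℚ 4 * H ω) * M) * cost par w C′ ∎
    where open +-*-Solver

-- Existence of a run

-- Completion times are found slot by slot.  After slot t, the completion times
-- exceeding t are still unknown and are represented by the value t + 1.
module Simulation
  {n : ℕ} (par : Forest n) (acyclic : Acyclic par) {p : Fin n → ℚ} (0≤p : ∀ j → 0ℚ ≤ p j)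
  (R : (Fin n → ℕ) → Rates par)
  (R-cong : ∀ {C C⁺ t} → (∀ j → front par C t j ≡ front par C⁺ t j) → ∀ j → R C t j ≡ R C⁺ t j)
  (idle : ∀ C {t j} → front par C t j ≡ false → R C t j ≡ 0ℚ)
  (slowdown : ℚ) (0≤slowdown : 0ℚ ≤ slowdown)
  (ind-front≤ : ∀ C t j → ind (front par C t j) ≤ slowdown * R C t j)
  where

  Done : (Fin n → ℕ) → Fin n → ℕ → Set
  Done C j t = Ready par C j t × p j ≤ cum par (R C) t j

  Done? : ∀ C j t → Dec (Done C j t)
  Done? C j t = Ready? par C j t ×-dec (p j ≤? cum par (R C) t j)

  record Partial (t : ℕ) (C : Fin n → ℕ) : Set where
    field
      lower   : ∀ j → 1 ℕ.≤ C j
      upper   : ∀ j → C j ℕ.≤ suc t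
      done    : ∀ j → C j ℕ.≤ t → Done C j (C j)
      minimal : Minimal par p (R C) C

  -- Equality after truncation at `t`, which is all that readiness and fronts in slots up to `t` can
  -- detect.
  Agree : ℕ → (Fin n → ℕ) → (Fin n → ℕ) → Set
  Agree t C C⁺ = ∀ j s → s ℕ.≤ t → (s ℕ.≤ C j → s ℕ.≤ C⁺ j) × (s ℕ.≤ C⁺ j → s ℕ.≤ C j)

  Agree-sym : ∀ {t C C⁺} → Agree t C C⁺ → Agree t C⁺ C
  Agree-sym agree j s s≤t = proj₂ (agree j s s≤t) , proj₁ (agree j s s≤t)

  Ready-agree : ∀ {t C C⁺} → Agree t C C⁺ → ∀ {j s} → s ℕ.≤ t → Ready par C j s → Ready par C⁺ j s
  Ready-agree agree {j} {s} s≤t ready j′ eq = ℕP.≰⇒> λ s≤C⁺ →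
    contradiction (ready j′ eq) (ℕP.≤⇒≯ (proj₂ (agree j′ s s≤t) s≤C⁺))

  front-agree : ∀ {t C C⁺} → Agree t C C⁺ → ∀ {s} → s ℕ.≤ t → ∀ j → front par C s j ≡ front par C⁺ s j
  front-agree {t} {C} {C⁺} agree {s} s≤t j = ≡true-iff (transfer C C⁺ agree) (transfer C⁺ C (Agree-sym agree))
    where
    transfer : ∀ C C⁺ → Agree t C C⁺ → InFront par C s j → InFront par C⁺ s j
    transfer C C⁺ agree fr = let s≤C , ready = front-sound par C fr in
      front-complete par C⁺ (proj₁ (agree j s s≤t) s≤C) (Ready-agree agree s≤t ready)

  cum-agree : ∀ {t C C⁺} → Agree t C C⁺ → ∀ s → s ℕ.≤ t → ∀ j → cum par (R C) s j ≡ cum par (R C⁺) s j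
  cum-agree agree zero    s≤t j = refl
  cum-agree agree (suc s) s<t j = cong₂ _+_ (cum-agree agree s (ℕP.<⇒≤ s<t) j) (R-cong (front-agree agree s<t) j)

  Done-agree : ∀ {t C C⁺} → Agree t C C⁺ → ∀ {j s} → s ℕ.≤ t → Done C j s → Done C⁺ j s
  Done-agree agree {j} {s} s≤t (ready , p≤cum) =
    Ready-agree agree s≤t ready , ≤-trans p≤cum (≤-reflexive (cum-agree agree s s≤t j))

  -- The new completion time is an index, so each invariant of a step follows by one case analysis.
  data Next (t : ℕ) (C : Fin n → ℕ) (j : Fin n) : ℕ → Set where
    keep   : C j ℕ.≤ t → Next t C j (C j)
    finish : C j ≡ suc t → Done C j (suc t) → Next t C j (suc t)
    defer  : C j ≡ suc t → ¬ Done C j (suc t) → Next t C j (suc (suc t))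

  next : ∀ {t C} → Partial t C → ∀ j → ∃ (Next t C j)
  next {t} {C} P j = case C j ℕ.≤? t of λ
    { (yes C≤t) → C j , keep C≤t
    ; (no C≰t)  → let C≡ = ℕP.≤-antisym (Partial.upper P j) (ℕP.≰⇒> C≰t) in
        case Done? C j (suc t) of λ
          { (yes d) → suc t , finish C≡ d
          ; (no ¬d) → suc (suc t) , defer C≡ ¬d } }

  step : ∀ {t C} → Partial t C → ∃ (Partial (suc t))
  step {t} {C} P = C⁺ , record
    { lower   = λ j → lower⁺ j (proj₂ (next P j))
    ; upper   = λ j → upper⁺ j (proj₂ (next P j))
    ; done    = λ j → done⁺ j (proj₂ (next P j))
    ; minimal = λ j s 1≤s s<C⁺ d → minimal⁺ j (proj₂ (next P j)) s 1≤s s<C⁺ d }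
    where
    open Partial P
    C⁺ : Fin n → ℕ
    C⁺ j = proj₁ (next P j)
    lower⁺ : ∀ j {c} → Next t C j c → 1 ℕ.≤ c
    lower⁺ j (keep _)     = lower j
    lower⁺ j (finish _ _) = ℕ.s≤s ℕ.z≤n
    lower⁺ j (defer _ _)  = ℕ.s≤s ℕ.z≤n
    upper⁺ : ∀ j {c} → Next t C j c → c ℕ.≤ suc (suc t)
    upper⁺ j (keep C≤t)   = ℕP.m≤n⇒m≤1+n (ℕP.m≤n⇒m≤1+n C≤t)
    upper⁺ j (finish _ _) = ℕP.n≤1+n (suc t)
    upper⁺ j (defer _ _)  = ℕP.≤-refl
    agree′ : ∀ j {c} → Next t C j c → ∀ s → s ℕ.≤ suc t → (s ℕ.≤ C j → s ℕ.≤ c) × (s ℕ.≤ c → s ℕ.≤ C j)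
    agree′ j (keep _)      s s≤ = (λ h → h) , (λ h → h)
    agree′ j (finish C≡ _) s s≤ = (λ _ → s≤) , (λ _ → ℕP.≤-trans s≤ (ℕP.≤-reflexive (sym C≡)))
    agree′ j (defer C≡ _)  s s≤ = (λ _ → ℕP.m≤n⇒m≤1+n s≤) , (λ _ → ℕP.≤-trans s≤ (ℕP.≤-reflexive (sym C≡)))
    -- A placeholder `t` + 1 is replaced by `t` + 1 or `t` + 2, so nothing changes for slots up to
    -- `t` + 1; the decision for slot `t` + 1 cannot affect its own front.
    agree : Agree (suc t) C C⁺
    agree j = agree′ j (proj₂ (next P j))
    done⁺ : ∀ j {c} → Next t C j c → c ℕ.≤ suc t → Done C⁺ j c
    done⁺ j (keep C≤t)   _  = Done-agree agree (ℕP.m≤n⇒m≤1+n C≤t) (done j C≤t)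
    done⁺ j (finish _ d) _  = Done-agree agree ℕP.≤-refl d
    done⁺ j (defer _ _)  c≤ = contradiction c≤ (ℕP.<⇒≱ ℕP.≤-refl)
    minimal⁺ : ∀ j {c} → Next t C j c → ∀ s → 1 ℕ.≤ s → s ℕ.< c → ¬ Done C⁺ j s
    minimal⁺ j (keep C≤t) s 1≤s s<C d =
      minimal j s 1≤s s<C (Done-agree (Agree-sym agree) (ℕP.m≤n⇒m≤1+n (ℕP.≤-trans (ℕP.<⇒≤ s<C) C≤t)) d)
    minimal⁺ j (finish C≡ _) s 1≤s s<1+t d =
      minimal j s 1≤s (ℕP.<-≤-trans s<1+t (ℕP.≤-reflexive (sym C≡))) (Done-agree (Agree-sym agree) (ℕP.<⇒≤ s<1+t) d)
    minimal⁺ j (defer C≡ ¬d) s 1≤s s<2+t d = case ℕP.m≤n⇒m<n∨m≡n (ℕP.≤-pred s<2+t) of λ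
      { (inj₁ s<1+t) → minimal j s 1≤s (ℕP.<-≤-trans s<1+t (ℕP.≤-reflexive (sym C≡)))
                         (Done-agree (Agree-sym agree) (ℕP.<⇒≤ s<1+t) d)
      ; (inj₂ refl)  → ¬d (Done-agree (Agree-sym agree) ℕP.≤-refl d) }

  simulate : ∀ t → ∃ (Partial t)
  simulate zero = (λ _ → 1) , record
    { lower   = λ _ → ℕP.≤-refl
    ; upper   = λ _ → ℕP.≤-refl
    ; done    = λ _ ()
    ; minimal = λ _ s 1≤s s<1 _ → contradiction 1≤s (ℕP.<⇒≱ s<1) }
  simulate (suc t) = step (proj₂ (simulate t))

  horizon : ℚ
  horizon = sumFin (λ a → 1ℚ + slowdown * p a)

  -- In every slot up to C j some job is in the front, and each job a is in the
  -- front for at most 1 + slowdown * p a slots.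
  C≤horizon : ∀ {t C} → Partial t C → ∀ j → ℕ→ℚ (C j) ≤ horizon
  C≤horizon {t} {C} P j = begin
    ℕ→ℚ (C j)
      ≤⟨ count≤sum (Partial.upper P j) (λ s → sumFin (φ s)) (λ s → 0≤sum (0≤φ s)) 1≤Σφ ⟩
    sumFin {suc t} (λ s → sumFin (φ (toℕ s)))
      ≡⟨ sum-swap {m = suc t} (λ s a → φ (toℕ s) a) ⟩
    sumFin (λ a → sumFin {suc t} (λ s → φ (toℕ s) a))
      ≤⟨ sum-mono front-slots ⟩
    horizon ∎
    where
    open ≤-Reasoning
    φ : ℕ → Fin n → ℚ
    φ s a = ind (front par C (suc s) a)
    0≤φ : ∀ s a → 0ℚ ≤ φ s a
    0≤φ s a = 0≤ind (front par C (suc s) a)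
    1≤Σφ : ∀ s → s ℕ.< C j → 1ℚ ≤ sumFin (φ s)
    1≤Σφ s s<C = let a , fa , _ = front-ancestor par C acyclic s<C in
      ≤-trans (≤-reflexive (cong ind (sym fa))) (term≤sum {f = φ s} (0≤φ s) a)
    busy : ℕ → Fin n → Bool
    busy s a = ⌊ suc s ℕ.<? C a ⌋
    y y′ : Fin n → ℕ → ℚ
    y  a s = R C (suc s) a * ind (busy s a)
    y′ a s = φ s a * ind (not (busy s a))
    -- A front slot of a job is either its last one or is paid for by `slowdown` times the rate in
    -- it.
    split : ∀ {x z} b → x ≤ slowdown * z → x ≤ x * ind (not b) + slowdown * (z * ind b)
    split {x} {z} true  x≤ = ≤-trans x≤ (≤-reflexive (solve 3 (λ x q z → q :* z := x :* con 0ℚ :+ q :* (z :* con 1ℚ)) refl x slowdown z))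
      where open +-*-Solver
    split {x} {z} false x≤ = ≤-reflexive (solve 3 (λ x q z → x := x :* con 1ℚ :+ q :* (z :* con 0ℚ)) refl x slowdown z)
      where open +-*-Solver
    front-slots : ∀ a → sumFin {suc t} (λ s → φ (toℕ s) a) ≤ 1ℚ + slowdown * p a
    front-slots a = begin
      sumFin {suc t} (λ s → φ (toℕ s) a)
        ≤⟨ sum-mono {n = suc t} (λ s → split (busy (toℕ s) a) (ind-front≤ C (suc (toℕ s)) a)) ⟩
      sumFin {suc t} (λ s → y′ a (toℕ s) + slowdown * y a (toℕ s))
        ≡⟨ trans (sum-+ {n = suc t} (λ s → y′ a (toℕ s)) (λ s → slowdown * y a (toℕ s)))
             (cong (sumFin {suc t} (λ s → y′ a (toℕ s)) +_) (sum-*ˡ {n = suc t} slowdown (λ s → y a (toℕ s)))) ⟩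
      sumFin {suc t} (λ s → y′ a (toℕ s)) + slowdown * sumFin {suc t} (λ s → y a (toℕ s))
        ≤⟨ +-mono-≤ (final-slot par C (suc t) a)
             (*-monoʳ-≤ 0≤slowdown (FrontRun.processed≤p par C (R C) (idle C) p 0≤p (Partial.minimal P) (suc t) a)) ⟩
      1ℚ + slowdown * p a ∎

  -- The horizon depends neither on the stopping slot nor on the partial run, so a simulation
  -- stopped at a natural number above it contains no placeholder.
  run : ∃ λ T → ∃ λ C → (∀ j → C j ℕ.≤ T) × IsCompletion par p (R C) C
  run = let T , horizon≤T = ≤-archimedean horizon
            C , P = simulate T
            C≤T = λ j → ℕ→ℚ-cancel-≤ (≤-trans (C≤horizon P j) horizon≤T)
        in T , C , C≤T , λ j → (Partial.lower P j , Partial.done P j (C≤T j)) , Partial.minimal P j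

theorem9 : ∀ {n : ℕ} (par : Forest n) → Acyclic par
    → (p w : Fin n → ℚ) → (∀ j → 0ℚ ≤ p j) → (∀ j → 0ℚ ≤ w j)
    → (ε : ℚ) → 0ℚ < ε
    → (π : Predictions par) → ValidPredictions par π
    → (ω : ℕ) → IsWidth par ω
    → ∃ λ (R : Rates par) → ∃ λ (C : Fin n → ℕ)
    → IsAlgRun par p π R C
    × (∀ (L : ℕ) → IsL par w ε π C L
    → ∀ (R' : Rates par) (C' : Fin n → ℕ)
    → Feasible par R' C' → IsCompletion par p R' C'
    → cost par w C ≤ ((ℕ→ℚ 4 * H ω) * ((1ℚ + ε) ⊔ ℕ→ℚ L)) * cost par w C')
theorem9 {n} par acyclic p w 0≤p 0≤w ε 0<ε π valid ω width =
  let T , C , C≤T , completion = Simulation.run par acyclic 0≤p (algRate par π)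
        (λ {_} {_} {t} → rate-cong (π t)) (λ C {t} {j} → if-false)
        -- The slowdown is the inverse of the smallest rate that a front job can have according to
        -- `ind≤rate`.
        (H n * ℕ→ℚ n) (0≤* (0≤H n) (0≤ℕ→ℚ n))
        (λ C t → Ranking.ind≤rate (front par C t) (π t))
  in algRate par π C , C , (completion , λ _ _ _ → refl) ,
     λ L isL R' C' feasible completion' → Competitive.competitive par acyclic 0≤p 0≤w 0<ε π valid width
       C (λ j → proj₁ (proj₂ (proj₁ (completion j))))
       (algRate par π C)
       (λ t → Ranking.0≤rate (front par C t) (π t))
       (λ t → Ranking.sum-rate≤1 (front par C t) (π t) (valid t))
       (λ {t} {j} → if-false)
       (λ {t} {j} → Ranking.rate-inverse (front par C t) (π t))
       (λ {t} → Ranking.rate-antimono (front par C t) (π t))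
       (λ j → proj₂ (completion j))
       (proj₁ isL) feasible completion' T C≤T
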